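{- Let $s$ be a degree sequence and let $G,H\in\mathcal{P}(s)$. Then there exists a sequence of p-switches transforming $G$ into $H$; that is, there are 2-switches $\tau_1,\dots,\tau_k$ ($k\ge0$) such that, with $G_0=G$ and $G_i=\tau_i(G_{i-1})$, each $\tau_i$ is a p-switch over $G_{i-1}$ and $G_k=H$.
   Context: All graphs are finite, simple, undirected and labeled, with vertex set $[n]$. The degree sequence of a graph $G$ with $V(G)=[n]$ is $(d_1,\dots,d_n)$ where $d_i$ is the degree of vertex $i$. A pseudoforest is a graph each of whose connected components contains at most one cycle (i.e. each component is a tree or a unicyclic graph, a unicyclic graph being a connected graph with exactly one cycle). $\mathcal{P}(s)$ is the set of pseudoforests with degree sequence $s$. For $a,b,c,d\in[n]$, the matrix $A=\binom{a\ b}{c\ d}$ is interchangeable in $G$ if $ab,cd\in E(G)$, $\{a,b\}\cap\{c,d\}=\varnothing$ and $ac,bd\notin E(G)$. The 2-switch $\tau_A$ sends $G$ to $G-ab-cd+ac+bd$ if $A$ is interchangeable in $G$, and to $G$ otherwise (then $\tau_A$ is trivial for $G$). A nontrivial 2-switch $\tau$ over a pseudoforest $G$ is a p-switch if $\tau(G)$ is a pseudoforest. The empty sequence is allowed. -}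

module Defs where

open import Data.Bool using (Bool; true; false; not; _∧_; _∨_)
open import Data.Bool.Properties using (∧-comm; ∨-comm) renaming (_≟_ to _≟ᵇ_)
open import Data.Empty using (⊥-elim)
open import Data.Fin using (Fin)
open import Data.Fin.Properties using (_≟_)
open import Data.Fin.Subset using (Subset; ∣_∣)
open import Data.List using (List; []; _∷_; _∷ʳ_; length; zip)
open import Data.List.Membership.Propositional using () renaming (_∈_ to _∈ˡ_)
open import Data.List.Relation.Unary.All using (All)
open import Data.List.Relation.Unary.Unique.Propositional using (Unique)
open import Data.Nat using (ℕ; _≤_)
open import Data.Product using (∃; _×_; _,_; uncurry)
open import Data.Sum using (_⊎_)
open import Data.Vec using (Vec; tabulate)
open import Function.Bundles using (_⇔_)
open import Level using (0ℓ)
open import Relation.Binary.Construct.Closure.ReflexiveTransitive using (Star)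
open import Relation.Binary.PropositionalEquality
  using (_≡_; _≢_; refl; sym; trans; cong₂)
open import Relation.Nullary using (¬_; Dec; yes; no; does; ¬?; _×-dec_)
open import Relation.Unary using (Pred)

record Graph (n : ℕ) : Set where
  field
    adj        : Fin n → Fin n → Bool
    adj-sym    : ∀ i j → adj i j ≡ adj j i
    adj-irrefl : ∀ i → adj i i ≡ false

open Graph public

private
  variable
    n : ℕ

Edge : Graph n → Fin n → Fin n → Set
Edge G i j = adj G i j ≡ true

-- Equality of labeled graphs.  Propositional equality of records would also
-- compare functions and proofs, which is too fine without extensionality.
infix 4 _≈_

_≈_ : Graph n → Graph n → Set
G ≈ H = ∀ i j → adj G i j ≡ adj H i j

neighbours : Graph n → Fin n → Subset n
neighbours G i = tabulate (adj G i)

degree : Graph n → Fin n → ℕ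
degree G i = ∣ neighbours G i ∣

degreeSequence : Graph n → Vec ℕ n
degreeSequence G = tabulate (degree G)

IsDegreeSequence : Vec ℕ n → Set
IsDegreeSequence {n} s = ∃ λ (G : Graph n) → degreeSequence G ≡ s

Connected : Graph n → Fin n → Fin n → Set
Connected G = Star (Edge G)

-- For x₁ … xₘ: the pairs (x₁ , x₂) , … , (xₘ₋₁ , xₘ) , (xₘ , x₁).
cyclicPairs : {A : Set} → List A → List (A × A)
cyclicPairs []       = []
cyclicPairs (x ∷ xs) = zip (x ∷ xs) (xs ∷ʳ x)

record Cycle (G : Graph n) : Set where
  field
    vertices : List (Fin n)
    long     : 3 ≤ length vertices
    distinct : Unique vertices
    closed   : All (uncurry (Edge G)) (cyclicPairs vertices)

open Cycle public

CycleEdge : {G : Graph n} → Cycle G → Fin n → Fin n → Set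
CycleEdge C i j =
  (i , j) ∈ˡ cyclicPairs (vertices C) ⊎ (j , i) ∈ˡ cyclicPairs (vertices C)

-- Cycles are identified as subgraphs: the starting point and the direction
-- of the vertex enumeration are immaterial.
SameCycle : {G : Graph n} → Cycle G → Cycle G → Set
SameCycle C D = ∀ i j → CycleEdge C i j ⇔ CycleEdge D i j

InComponentOf : {G : Graph n} → Fin n → Cycle G → Set
InComponentOf {G = G} v C = All (Connected G v) (vertices C)

-- The connected components are the classes of Connected, so they are indexed
-- (with repetition) by a vertex v.
Pseudoforest : Graph n → Set
Pseudoforest G =
  ∀ v (C D : Cycle G) → InComponentOf v C → InComponentOf v D → SameCycle C D

𝒫 : Vec ℕ n → Pred (Graph n) 0ℓ
𝒫 s G = Pseudoforest G × degreeSequence G ≡ s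

-- isPair a b i j decides {i , j} = {a , b}.
isPair : Fin n → Fin n → Fin n → Fin n → Bool
isPair a b i j =
  (does (i ≟ a) ∧ does (j ≟ b)) ∨ (does (j ≟ a) ∧ does (i ≟ b))

isPair-sym : ∀ (a b i j : Fin n) → isPair a b i j ≡ isPair a b j i
isPair-sym a b i j =
  ∨-comm (does (i ≟ a) ∧ does (j ≟ b)) (does (j ≟ a) ∧ does (i ≟ b))

isPair-irrefl : ∀ {a b : Fin n} → a ≢ b → ∀ i → isPair a b i i ≡ false
isPair-irrefl {a = a} {b} a≢b i with i ≟ a | i ≟ b
... | yes i≡a | yes i≡b = ⊥-elim (a≢b (trans (sym i≡a) i≡b))
... | yes _   | no  _   = refl
... | no  _   | _       = refl

deleteEdge : (a b : Fin n) → Graph n → Graph n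
deleteEdge a b G = record
  { adj        = λ i j → adj G i j ∧ not (isPair a b i j)
  ; adj-sym    = λ i j → cong₂ (λ x y → x ∧ not y) (adj-sym G i j) (isPair-sym a b i j)
  ; adj-irrefl = λ i → cong₂ _∧_ (adj-irrefl G i) refl
  }

insertEdge : (a b : Fin n) → a ≢ b → Graph n → Graph n
insertEdge a b a≢b G = record
  { adj        = λ i j → adj G i j ∨ isPair a b i j
  ; adj-sym    = λ i j → cong₂ _∨_ (adj-sym G i j) (isPair-sym a b i j)
  ; adj-irrefl = λ i → cong₂ _∨_ (adj-irrefl G i) (isPair-irrefl a≢b i)
  }

-- The matrix with rows  a b  and  c d ; entries are not assumed distinct.
record Matrix (n : ℕ) : Set where
  constructor matrix
  field
    a b c d : Fin n

Interchangeable : Matrix n → Graph n → Set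
Interchangeable (matrix a b c d) G =
    (Edge G a b × Edge G c d)
  × (a ≢ c × a ≢ d × b ≢ c × b ≢ d)
  × (¬ Edge G a c × ¬ Edge G b d)

interchangeable? : (A : Matrix n) (G : Graph n) → Dec (Interchangeable A G)
interchangeable? (matrix a b c d) G =
    (edge? a b ×-dec edge? c d)
  ×-dec (a ≢? c ×-dec a ≢? d ×-dec b ≢? c ×-dec b ≢? d)
  ×-dec (¬? (edge? a c) ×-dec ¬? (edge? b d))
  where
  edge? : ∀ i j → Dec (Edge G i j)
  edge? i j = adj G i j ≟ᵇ true

  _≢?_ : ∀ i j → Dec (i ≢ j)
  i ≢? j = ¬? (i ≟ j)

  infix 4 _≢?_

switch : Matrix n → Graph n → Graph n
switch A@(matrix a b c d) G with interchangeable? A G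
... | yes (_ , (a≢c , _ , _ , b≢d) , _) =
  insertEdge b d b≢d (insertEdge a c a≢c (deleteEdge c d (deleteEdge a b G)))
... | no _ = G

-- A switch is nontrivial for G exactly when its matrix is interchangeable in G.
record IsPSwitch (A : Matrix n) (G : Graph n) : Set where
  field
    source     : Pseudoforest G
    nontrivial : Interchangeable A G
    target     : Pseudoforest (switch A G)

infix 4 _⟶ₚ_

_⟶ₚ_ : Graph n → Graph n → Set
G ⟶ₚ G′ = ∃ λ A → IsPSwitch A G × G′ ≡ switch A G

-- A possibly empty sequence of p-switches starting at G and ending at a graph
-- equal to H as a labeled graph.
TransformsByPSwitches : Graph n → Graph n → Set
TransformsByPSwitches G H = ∃ λ K → Star _⟶ₚ_ G K × K ≈ H

-- A graph is a pseudoforest iff its edges are covered by the pairs {i , f i} of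
-- some self-map f of the vertices, i.e. iff it has an orientation of outdegree ≤ 1.
-- Induct on the number of edges.  If some vertex z has degree ≥ 3, then f takes
-- the value z twice, so f is not surjective and a vertex l outside its image is a
-- leaf.  The leaf can be moved to z by one p-switch, both in G and in H (l is a leaf
-- of H too): if l hangs at u, exchange the edges lu and zw for lz and uw, where w
-- is a suitable child of z, and redirect f w to u.  Once lz is an edge
-- of both graphs, delete it and apply the induction hypothesis.  If all degrees are
-- ≤ 2, every graph with the given degrees is a pseudoforest, and the rows of
-- the two adjacency matrices can be made equal one vertex x at a time: for a vertex u
-- adjacent to x in G only and v adjacent to x in H only, compare the degrees of u and v
-- among the unprocessed vertices; a switch in G or in H then removes the discrepancy at u.

module Submission where

open import Defs
open import Data.Bool using (Bool; true; false; not; _∧_; _∨_; if_then_else_)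
open import Data.Bool.Properties
  using (∧-identityʳ; ∧-comm; ∨-comm; ∨-identityʳ; ∨-zeroʳ)
import Data.Bool.Properties as Bool
open import Data.Empty using (⊥; ⊥-elim)
open import Data.Fin using (Fin; zero; suc; toℕ)
import Data.Fin as Fin
open import Data.Fin.Properties using (_≟_; any?; pigeonhole)
import Data.Fin.Properties as Fin
open import Data.Fin.Subset using (∣_∣)
open import Data.List using (List; []; _∷_; _∷ʳ_; zip; length; allFin)
import Data.List.Membership.DecPropositional as DecMembership
open import Data.List.Membership.Propositional using (_∉_) renaming (_∈_ to _∈ˡ_)
open import Data.List.Membership.Propositional.Properties using (∈-++⁻; ∈-++⁺ˡ; ∈-allFin)
open import Data.List.Relation.Unary.All using (All; []; _∷_)
import Data.List.Relation.Unary.All as All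
open import Data.List.Relation.Unary.All.Properties using (∷ʳ⁺; ¬Any⇒All¬)
open import Data.List.Relation.Unary.AllPairs using ([]; _∷_)
open import Data.List.Relation.Unary.Any using (here; there)
open import Data.List.Relation.Unary.Unique.Propositional using (Unique)
open import Data.Nat using (ℕ; zero; suc; _+_; _∸_; _≤_; _<_; z≤n; s≤s; _≤?_)
open import Data.Nat.GeneralisedArithmetic using (iterate)
open import Data.Nat.Properties hiding (_≟_; _≤?_)
open import Data.Product using (∃; ∃₂; _×_; _,_; proj₁; proj₂; uncurry)
open import Data.Sum using (_⊎_; inj₁; inj₂; [_,_]′; swap)
open import Data.Vec using (Vec; tabulate; lookup)
import Data.Vec as Vec
open import Data.Vec.Properties using (tabulate-cong; lookup∘tabulate)
open import Function using (_∘_; id)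
open import Function.Bundles using (mk⇔; Equivalence)
open import Level using (0ℓ)
open import Relation.Binary using (Rel)
open import Relation.Binary.Construct.Closure.ReflexiveTransitive as Star
  using (Star; ε; _◅_; _◅◅_)
open import Relation.Binary.PropositionalEquality
open import Relation.Nullary using (¬_; Dec; yes; no; does; contradiction; ¬?)
open import Relation.Nullary.Decidable using (dec-true; dec-false; decidable-stable)
open import Relation.Unary using (_∈_)

private
  variable
    n : ℕ
    X : Set

-- Counting

true≢false : true ≢ false
true≢false ()

∧⁺ : ∀ {x y} → x ≡ true → y ≡ true → x ∧ y ≡ true
∧⁺ refl refl = refl

∧⁻ : ∀ {x y} → x ∧ y ≡ true → x ≡ true × y ≡ true
∧⁻ {true} {true} refl = refl , refl

∨⁻ : ∀ {x y} → x ∨ y ≡ true → x ≡ true ⊎ y ≡ true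
∨⁻ {true}  _ = inj₁ refl
∨⁻ {false} e = inj₂ e

∨⁺ˡ : ∀ {x y} → x ≡ true → x ∨ y ≡ true
∨⁺ˡ refl = refl

∨⁺ʳ : ∀ {x y} → y ≡ true → x ∨ y ≡ true
∨⁺ʳ {true}  refl = refl
∨⁺ʳ {false} refl = refl

not⁺ : ∀ {x} → ¬ (x ≡ true) → not x ≡ true
not⁺ {true}  x≢true = contradiction refl x≢true
not⁺ {false} _      = refl

not⁻ : ∀ {x} → not x ≡ true → ¬ (x ≡ true)
not⁻ {false} _ ()

does⁻ : ∀ {A : Set} (A? : Dec A) → does A? ≡ true → A
does⁻ (yes a) _ = a

⇔⇒≡ : ∀ {x y} → (x ≡ true → y ≡ true) → (y ≡ true → x ≡ true) → x ≡ y
⇔⇒≡ {true}  {true}  _ _ = refl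
⇔⇒≡ {true}  {false} f _ = sym (f refl)
⇔⇒≡ {false} {true}  _ g = g refl
⇔⇒≡ {false} {false} _ _ = refl

BoolPred : ℕ → Set
BoolPred n = Fin n → Bool

count : BoolPred n → ℕ
count p = ∣ tabulate p ∣

infix 4 _⊆ᵇ_
infixl 6 _∖_

_⊆ᵇ_ : BoolPred n → BoolPred n → Set
p ⊆ᵇ q = ∀ j → p j ≡ true → q j ≡ true

_∖_ : BoolPred n → Fin n → BoolPred n
(p ∖ i) j = p j ∧ not (does (j ≟ i))

∖⁺ : ∀ (p : BoolPred n) {i j} → p j ≡ true → j ≢ i → (p ∖ i) j ≡ true
∖⁺ p {i} {j} pj j≢i = ∧⁺ pj (cong not (dec-false (j ≟ i) j≢i))

∖⁻ : ∀ (p : BoolPred n) {i j} → (p ∖ i) j ≡ true → p j ≡ true × j ≢ i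
∖⁻ p {i} {j} e with ∧⁻ {p j} e
... | pj , j≠i = pj , λ j≡i → not⁻ j≠i (dec-true (j ≟ i) j≡i)

count-mono : {p q : BoolPred n} → p ⊆ᵇ q → count p ≤ count q
count-mono {n = zero}          p⊆q = z≤n
count-mono {n = suc n} {p} {q} p⊆q
  with p zero | q zero | p⊆q zero | count-mono {p = p ∘ suc} {q ∘ suc} (p⊆q ∘ suc)
... | true  | true  | _ | r = s≤s r
... | true  | false | h | r = contradiction (h refl) λ ()
... | false | true  | _ | r = m≤n⇒m≤1+n r
... | false | false | _ | r = r

count-cong : {p q : BoolPred n} → (∀ j → p j ≡ q j) → count p ≡ count q
count-cong p≗q = ≤-antisym (count-mono λ j pj → trans (sym (p≗q j)) pj)
                           (count-mono λ j qj → trans (p≗q j) qj)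

count-∖ : ∀ {p : BoolPred n} {i} → p i ≡ true → count p ≡ suc (count (p ∖ i))
count-∖ {n = suc n} {p} {zero} pi rewrite pi =
  cong suc (count-cong λ j → sym (∧-identityʳ (p (suc j))))
count-∖ {n = suc n} {p} {suc i} pi with p zero
... | true  = cong suc (count-∖ {p = p ∘ suc} pi)
... | false = count-∖ {p = p ∘ suc} pi

count-∖-∸ : ∀ {p : BoolPred n} {i} → count p ∸ 1 ≤ count (p ∖ i)
count-∖-∸ {p = p} {i} with p i in eq
... | true  rewrite count-∖ {p = p} eq = ≤-refl
... | false = ≤-trans (m∸n≤m _ 1) (count-mono {p = p} {p ∖ i} λ j pj →
                ∖⁺ p pj λ { refl → contradiction (trans (sym pj) eq) true≢false })

count-pick : ∀ {p q : BoolPred n} → count q < count p →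
             ∃ λ w → p w ≡ true × ¬ (q w ≡ true)
count-pick {n = suc n} {p} {q} q<p
  with p zero in pe | q zero in qe
... | true | false = zero , pe , λ q0 → contradiction (trans (sym q0) qe) true≢false
... | true | true with count-pick {p = p ∘ suc} {q ∘ suc} (≤-pred q<p)
...   | w , pw , qw = suc w , pw , qw
count-pick {n = suc n} {p} {q} q<p | false | false
  with count-pick {p = p ∘ suc} {q ∘ suc} q<p
...   | w , pw , qw = suc w , pw , qw
count-pick {n = suc n} {p} {q} q<p | false | true
  with count-pick {p = p ∘ suc} {q ∘ suc} (<-trans (n<1+n _) q<p)
...   | w , pw , qw = suc w , pw , qw

-- Without `x`, `q` has fewer elements than `p`, so `p` has an element outside `q ∖ x`; it is not
-- `x`, which lies outside `p`.
count-swap : ∀ {p q : BoolPred n} {x} → count q ≤ count p →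
             q x ≡ true → ¬ (p x ≡ true) → ∃ λ w → p w ≡ true × ¬ (q w ≡ true)
count-swap {p = p} {q} {x} q≤p qx ¬px
  with w , pw , ¬qxw ← count-pick {p = p} {q ∖ x}
         (subst (_≤ count p) (count-∖ {p = q} qx) q≤p)
  = w , pw , λ qw → ¬qxw (∖⁺ q qw λ { refl → ¬px pw })

count-<-mono : ∀ {p q : BoolPred n} {x} → p ⊆ᵇ q → q x ≡ true → ¬ (p x ≡ true) →
               count p < count q
count-<-mono {p = p} {q} {x} p⊆q qx ¬px = subst (count p <_) (sym (count-∖ {p = q} qx))
  (s≤s (count-mono λ j pj → ∖⁺ q (p⊆q j pj) λ { refl → ¬px pj }))

count-false : {p : BoolPred n} → (∀ j → ¬ (p j ≡ true)) → count p ≡ 0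
count-false {n = zero}      _  = refl
count-false {n = suc n} {p} ¬p with p zero in eq
... | true  = contradiction eq (¬p zero)
... | false = count-false {p = p ∘ suc} (¬p ∘ suc)

count>0 : {p : BoolPred n} → 0 < count p → ∃ λ w → p w ≡ true
count>0 {n = n} {p} 0<p
  with w , pw , _ ← count-pick {p = p} {λ _ → false}
         (subst (_< count p) (sym (count-false {n = n} λ _ ())) 0<p)
  = w , pw

count≡1⇒unique : ∀ {p : BoolPred n} {i j} → count p ≡ 1 → p i ≡ true → p j ≡ true → j ≡ i
count≡1⇒unique {p = p} {i} {j} p≡1 pi pj with j ≟ i
... | yes j≡i = j≡i
... | no  j≢i = contradiction
  (trans (sym p≡1) (trans (count-∖ {p = p} pi) (cong suc (count-∖ {p = p ∖ i} (∖⁺ p pj j≢i)))))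
  λ ()

unique⇒count≡1 : ∀ {p : BoolPred n} {i} → p i ≡ true → (∀ j → p j ≡ true → j ≡ i) → count p ≡ 1
unique⇒count≡1 {p = p} pi only = trans (count-∖ {p = p} pi) (cong suc (count-false λ j pj →
  let pj′ , j≢i = ∖⁻ p pj in j≢i (only j pj′)))

count-split : ∀ (p m : BoolPred n) →
              count p ≡ count (λ j → p j ∧ m j) + count (λ j → p j ∧ not (m j))
count-split {n = zero}  p m = refl
count-split {n = suc n} p m with p zero | m zero | count-split (p ∘ suc) (m ∘ suc)
... | false | _     | r = r
... | true  | true  | r = cong suc r
... | true  | false | r = trans (cong suc r) (sym (+-suc _ _))

-- The second hypothesis ensures that the larger side loses an element only when the smaller side
-- does.
count-∖-mono : ∀ {p q : BoolPred n} {i j} → count p ≤ count q →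
               (q j ≡ true → p i ≡ true) → count (p ∖ i) ≤ count (q ∖ j)
count-∖-mono {p = p} {q} {i} {j} p≤q qj⇒pi with p i in pe
... | true  = ≤-trans (∸-monoˡ-≤ 1 (subst (_≤ count q) (count-∖ {p = p} pe) p≤q))
                      (count-∖-∸ {p = q})
... | false = begin
  count (p ∖ i) ≤⟨ count-mono {p = p ∖ i} {p} (λ _ → proj₁ ∘ ∖⁻ p) ⟩
  count p       ≤⟨ p≤q ⟩
  count q       ≤⟨ count-mono {p = q} {q ∖ j} (λ _ qk → ∖⁺ q qk
                     λ { refl → true≢false (sym (qj⇒pi qk)) }) ⟩
  count (q ∖ j) ∎
  where open ≤-Reasoning

-- Graphs and switches

edge-sym : ∀ (G : Graph n) {i j} → Edge G i j → Edge G j i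
edge-sym G {i} {j} = trans (adj-sym G j i)

edge⇒≢ : ∀ (G : Graph n) {i j} → Edge G i j → i ≢ j
edge⇒≢ G {i} ij refl = true≢false (trans (sym ij) (adj-irrefl G i))

≈-sym : {G H : Graph n} → G ≈ H → H ≈ G
≈-sym G≈H i j = sym (G≈H i j)

degree-cong : ∀ {G H : Graph n} → G ≈ H → ∀ i → degree G i ≡ degree H i
degree-cong {G = G} G≈H i = count-cong {p = adj G i} (G≈H i)

infix 4 _⊑_

_⊑_ : Graph n → Graph n → Set
G ⊑ H = ∀ {i j} → Edge G i j → Edge H i j

-- A cycle of `G` is a cycle of `H` on the same vertex list, and `CycleEdge` depends on that list
-- only.
Pseudoforest-⊑ : {G H : Graph n} → G ⊑ H → Pseudoforest H → Pseudoforest G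
Pseudoforest-⊑ G⊑H pf v C D v~C v~D =
  pf v (transport C) (transport D) (All.map (Star.map G⊑H) v~C) (All.map (Star.map G⊑H) v~D)
  where
  transport : Cycle _ → Cycle _
  transport C = record
    { vertices = vertices C
    ; long     = long C
    ; distinct = distinct C
    ; closed   = All.map G⊑H (closed C)
    }

Pseudoforest-≈ : {G H : Graph n} → G ≈ H → Pseudoforest G → Pseudoforest H
Pseudoforest-≈ {G = G} G≈H = Pseudoforest-⊑ (λ {i} {j} → trans (G≈H i j))

Pair : Fin n → Fin n → Fin n → Fin n → Set
Pair a b i j = (i ≡ a × j ≡ b) ⊎ (j ≡ a × i ≡ b)

isPair⁻ : ∀ {a b i j : Fin n} → isPair a b i j ≡ true → Pair a b i j
isPair⁻ {a = a} {b} {i} {j} e with ∨⁻ {does (i ≟ a) ∧ does (j ≟ b)} e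
... | inj₁ p = let ia , jb = ∧⁻ p in inj₁ (does⁻ (i ≟ a) ia , does⁻ (j ≟ b) jb)
... | inj₂ p = let ja , ib = ∧⁻ p in inj₂ (does⁻ (j ≟ a) ja , does⁻ (i ≟ b) ib)

isPair⁺ : ∀ {a b i j : Fin n} → Pair a b i j → isPair a b i j ≡ true
isPair⁺ {i = i} {j} (inj₁ (refl , refl)) =
  ∨⁺ˡ (∧⁺ (dec-true (i ≟ i) refl) (dec-true (j ≟ j) refl))
isPair⁺ {i = i} {j} (inj₂ (refl , refl)) =
  ∨⁺ʳ {does (i ≟ j) ∧ does (j ≟ i)} (∧⁺ (dec-true (j ≟ j) refl) (dec-true (i ≟ i) refl))

isPair-swap : ∀ (a b i j : Fin n) → isPair a b i j ≡ isPair b a i j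
isPair-swap a b i j = trans (∨-comm (does (i ≟ a) ∧ does (j ≟ b)) _)
  (cong₂ _∨_ (∧-comm (does (j ≟ a)) _) (∧-comm (does (i ≟ a)) _))

pair-sym : ∀ {a b i j : Fin n} → Pair a b i j → Pair a b j i
pair-sym (inj₁ p) = inj₂ p
pair-sym (inj₂ p) = inj₁ p

pair-swap : ∀ {a b i j : Fin n} → Pair a b i j → Pair b a i j
pair-swap (inj₁ (i≡a , j≡b)) = inj₂ (j≡b , i≡a)
pair-swap (inj₂ (j≡a , i≡b)) = inj₁ (i≡b , j≡a)

pair-edge : ∀ (G : Graph n) {a b i j} → Pair a b i j → Edge G a b → Edge G i j
pair-edge G (inj₁ (refl , refl)) ab = ab
pair-edge G (inj₂ (refl , refl)) ab = edge-sym G ab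

pair-edge⁻ : ∀ (G : Graph n) {a b i j} → Pair a b i j → Edge G i j → Edge G a b
pair-edge⁻ G (inj₁ (refl , refl)) ij = ij
pair-edge⁻ G (inj₂ (refl , refl)) ij = edge-sym G ij

deleteEdge⁻ : ∀ (G : Graph n) {a b i j} → Edge (deleteEdge a b G) i j → Edge G i j × ¬ Pair a b i j
deleteEdge⁻ G {i = i} {j} e with ∧⁻ {adj G i j} e
... | ij , ¬p = ij , not⁻ ¬p ∘ isPair⁺

deleteEdge⁺ : ∀ (G : Graph n) {a b i j} → Edge G i j → ¬ Pair a b i j → Edge (deleteEdge a b G) i j
deleteEdge⁺ G ij ¬p = ∧⁺ ij (not⁺ (¬p ∘ isPair⁻))

insertEdge⁻ : ∀ (G : Graph n) {a b a≢b i j} → Edge (insertEdge a b a≢b G) i j → Edge G i j ⊎ Pair a b i j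
insertEdge⁻ G {i = i} {j} e with ∨⁻ {adj G i j} e
... | inj₁ ij = inj₁ ij
... | inj₂ p  = inj₂ (isPair⁻ p)

insertEdge-cong : ∀ {G H : Graph n} {a b a≢b} → G ≈ H → insertEdge a b a≢b G ≈ insertEdge a b a≢b H
insertEdge-cong {a = a} {b} G≈H i j = cong (_∨ isPair a b i j) (G≈H i j)

insert-delete : ∀ {G : Graph n} {a b} (a≢b : a ≢ b) → Edge G a b →
                insertEdge a b a≢b (deleteEdge a b G) ≈ G
insert-delete {G = G} {a} {b} a≢b ab i j = ⇔⇒≡
  ([ proj₁ ∘ deleteEdge⁻ G , (λ p → pair-edge G p ab) ]′ ∘ insertEdge⁻ (deleteEdge a b G) {a≢b = a≢b})
  from
  where
  from : Edge G i j → Edge (insertEdge a b a≢b (deleteEdge a b G)) i j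
  from ij with isPair a b i j
  ... | true  = ∨⁺ʳ {adj G i j ∧ false} refl
  ... | false = ∨⁺ˡ (∧⁺ ij refl)

-- Degree sums and edge deletion

sum-mono : ∀ {n} {f g : Fin n → ℕ} → (∀ i → f i ≤ g i) →
           Vec.sum (tabulate f) ≤ Vec.sum (tabulate g)
sum-mono {zero}  f≤g = z≤n
sum-mono {suc n} f≤g = +-mono-≤ (f≤g zero) (sum-mono (f≤g ∘ suc))

sum-<-mono : ∀ {n} {f g : Fin n → ℕ} {x} → (∀ i → f i ≤ g i) → f x < g x →
             Vec.sum (tabulate f) < Vec.sum (tabulate g)
sum-<-mono {x = zero}  f≤g fx<gx = +-mono-<-≤ fx<gx (sum-mono (f≤g ∘ suc))
sum-<-mono {x = suc x} f≤g fx<gx = +-mono-≤-< (f≤g zero) (sum-<-mono {x = x} (f≤g ∘ suc) fx<gx)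

-- Twice the number of edges; the measure for the inductions on edges.
size : Graph n → ℕ
size G = Vec.sum (degreeSequence G)

size-deleteEdge : ∀ (G : Graph n) {a b} → Edge G a b → size (deleteEdge a b G) < size G
size-deleteEdge G {a} {b} ab = sum-<-mono {x = a}
  (λ i → count-mono {p = adj (deleteEdge a b G) i} {adj G i} (λ _ → proj₁ ∘ deleteEdge⁻ G))
  (count-<-mono {p = adj (deleteEdge a b G) a} {adj G a} (λ _ → proj₁ ∘ deleteEdge⁻ G)
    ab (λ ab′ → proj₂ (deleteEdge⁻ G ab′) (inj₁ (refl , refl))))

suc-degree-deleteEdge : ∀ (G : Graph n) {a b} → Edge G a b → suc (degree (deleteEdge a b G) a) ≡ degree G a
suc-degree-deleteEdge G {a} {b} ab = sym (trans (count-∖ {p = adj G a} ab)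
  (cong suc (count-cong {p = adj G a ∖ b} λ j → ⇔⇒≡
    (λ e → let aj , j≢b = ∖⁻ (adj G a) e in deleteEdge⁺ G aj
       λ { (inj₁ (_ , j≡b)) → j≢b j≡b ; (inj₂ (refl , _)) → edge⇒≢ G aj refl })
    (λ e → let aj , ¬p = deleteEdge⁻ G e in ∖⁺ (adj G a) aj λ j≡b → ¬p (inj₁ (refl , j≡b))))))

deleteEdge-swap : ∀ (G : Graph n) a b → deleteEdge a b G ≈ deleteEdge b a G
deleteEdge-swap G a b i j = cong (λ x → adj G i j ∧ not x) (isPair-swap a b i j)

degree-deleteEdge : ∀ (G H : Graph n) {a b} → Edge G a b → Edge H a b →
                    (∀ i → degree G i ≡ degree H i) →
                    ∀ i → degree (deleteEdge a b G) i ≡ degree (deleteEdge a b H) i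
degree-deleteEdge {n} G H {a} {b} abG abH G≡H i = by-cases (i ≟ a) (i ≟ b)
  where
  end : ∀ {a b} → Edge G a b → Edge H a b → degree (deleteEdge a b G) a ≡ degree (deleteEdge a b H) a
  end {a} abG abH = suc-injective
    (trans (suc-degree-deleteEdge G abG) (trans (G≡H a) (sym (suc-degree-deleteEdge H abH))))

  off : ∀ (K : Graph n) → i ≢ a → i ≢ b → degree (deleteEdge a b K) i ≡ degree K i
  off K i≢a i≢b = count-cong {p = adj (deleteEdge a b K) i} λ j → ⇔⇒≡
    (proj₁ ∘ deleteEdge⁻ K)
    (λ ij → deleteEdge⁺ K ij λ { (inj₁ (i≡a , _)) → i≢a i≡a ; (inj₂ (_ , i≡b)) → i≢b i≡b })

  by-cases : Dec (i ≡ a) → Dec (i ≡ b) → degree (deleteEdge a b G) i ≡ degree (deleteEdge a b H) i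
  by-cases (yes refl) _          = end abG abH
  by-cases (no _)     (yes refl) = trans
    (degree-cong {G = deleteEdge a b G} {deleteEdge b a G} (deleteEdge-swap G a b) i) (trans
    (end (edge-sym G abG) (edge-sym H abH))
    (degree-cong {G = deleteEdge b a H} {deleteEdge a b H} (deleteEdge-swap H b a) i))
  by-cases (no i≢a)   (no i≢b)   = trans (off G i≢a i≢b) (trans (G≡H i) (sym (off H i≢a i≢b)))

-- Nontrivial 2-switches as a relation

switchedAdj : Matrix n → Graph n → Fin n → Fin n → Bool
switchedAdj (matrix a b c d) G i j =
  (((adj G i j ∧ not (isPair a b i j)) ∧ not (isPair c d i j)) ∨ isPair a c i j) ∨ isPair b d i j

-- A relation, so that the result is fixed only up to `≈`: an inverse switch can then lead back to
-- `G` itself, and no case distinction on `interchangeable?` remains.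
record Swap (A : Matrix n) (G H : Graph n) : Set where
  constructor mkSwap
  field
    interchangeable : Interchangeable A G
    result          : ∀ i j → adj H i j ≡ switchedAdj A G i j

open Swap public

switch-swap : ∀ (A : Matrix n) (G : Graph n) → Interchangeable A G → Swap A G (switch A G)
switch-swap A G inter .interchangeable = inter
switch-swap A G inter .result i j with interchangeable? A G
... | yes _     = refl
... | no ¬inter = contradiction inter ¬inter

swap-cong : ∀ {A : Matrix n} {G G′ H} → G ≈ G′ → Swap A G H → Swap A G′ H
swap-cong {A = matrix a b c d} G≈G′ (mkSwap ((ab , cd) , ≢s , ac , bd) res) = mkSwap
  ((trans (sym (G≈G′ a b)) ab , trans (sym (G≈G′ c d)) cd) , ≢s ,
    (λ e → ac (trans (G≈G′ a c) e)) , (λ e → bd (trans (G≈G′ b d) e)))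
  (λ i j → trans (res i j) (cong
    (λ e → (((e ∧ not (isPair a b i j)) ∧ not (isPair c d i j)) ∨ isPair a c i j) ∨ isPair b d i j)
    (G≈G′ i j)))

module _ {a b c d : Fin n} {G H : Graph n} (σ : Swap (matrix a b c d) G H) where

  swap⁻ : ∀ {i j} → Edge H i j →
          (Edge G i j × ¬ Pair a b i j × ¬ Pair c d i j) ⊎ (Pair a c i j ⊎ Pair b d i j)
  swap⁻ {i} {j} ij with ∨⁻ (trans (sym (result σ i j)) ij)
  ... | inj₂ bd = inj₂ (inj₂ (isPair⁻ bd))
  ... | inj₁ e with ∨⁻ e
  ...   | inj₂ ac = inj₂ (inj₁ (isPair⁻ ac))
  ...   | inj₁ e′ =
    let e″ , ¬cd = ∧⁻ e′ ; ijG , ¬ab = ∧⁻ {adj G i j} e″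
    in inj₁ (ijG , not⁻ ¬ab ∘ isPair⁺ , not⁻ ¬cd ∘ isPair⁺)

  swap-keep : ∀ {i j} → Edge G i j → ¬ Pair a b i j → ¬ Pair c d i j → Edge H i j
  swap-keep {i} {j} ij ¬ab ¬cd = trans (result σ i j)
    (∨⁺ˡ (∨⁺ˡ (∧⁺ (∧⁺ ij (not⁺ (¬ab ∘ isPair⁻))) (not⁺ (¬cd ∘ isPair⁻)))))

  swap-new₁ : Edge H a c
  swap-new₁ = trans (result σ a c) (∨⁺ˡ (∨⁺ʳ
    {(adj G a c ∧ not (isPair a b a c)) ∧ not (isPair c d a c)} (isPair⁺ {i = a} {c} (inj₁ (refl , refl)))))

  swap-new₂ : Edge H b d
  swap-new₂ = trans (result σ b d) (∨⁺ʳ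
    {((adj G b d ∧ not (isPair a b b d)) ∧ not (isPair c d b d)) ∨ isPair a c b d}
    (isPair⁺ {i = b} {d} (inj₁ (refl , refl))))

  -- Together with `swap-turn`, this symmetry carries any of the four entries to the first position,
  -- so that degrees have to be compared at `a` only.
  swap-flip : Swap (matrix b a d c) G H
  swap-flip with ((ab , cd) , (a≢c , a≢d , b≢c , b≢d) , ac , bd) ← interchangeable σ = mkSwap
    ((edge-sym G ab , edge-sym G cd) , (b≢d , b≢c , a≢d , a≢c) , bd , ac)
    (λ i j → trans (result σ i j) (begin
      (((adj G i j ∧ not (isPair a b i j)) ∧ not (isPair c d i j)) ∨ isPair a c i j) ∨ isPair b d i j
        ≡⟨ cong₂ (λ p q → (((adj G i j ∧ not p) ∧ not q) ∨ isPair a c i j) ∨ isPair b d i j)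
             (isPair-swap a b i j) (isPair-swap c d i j) ⟩
      (((adj G i j ∧ not (isPair b a i j)) ∧ not (isPair d c i j)) ∨ isPair a c i j) ∨ isPair b d i j
        ≡⟨ lemma ((adj G i j ∧ not (isPair b a i j)) ∧ not (isPair d c i j)) _ _ ⟩
      (((adj G i j ∧ not (isPair b a i j)) ∧ not (isPair d c i j)) ∨ isPair b d i j) ∨ isPair a c i j
        ∎))
    where
    open ≡-Reasoning
    lemma : ∀ x y z → (x ∨ y) ∨ z ≡ (x ∨ z) ∨ y
    lemma true  _ _ = refl
    lemma false y z = ∨-comm y z

  swap-turn : Swap (matrix c d a b) G H
  swap-turn with ((ab , cd) , (a≢c , a≢d , b≢c , b≢d) , ac , bd) ← interchangeable σ = mkSwap
    ((cd , ab) , (a≢c ∘ sym , b≢c ∘ sym , a≢d ∘ sym , b≢d ∘ sym) , ac ∘ edge-sym G , bd ∘ edge-sym G)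
    (λ i j → trans (result σ i j) (begin
      (((adj G i j ∧ not (isPair a b i j)) ∧ not (isPair c d i j)) ∨ isPair a c i j) ∨ isPair b d i j
        ≡⟨ cong₂ (λ p q → (((adj G i j ∧ not (isPair a b i j)) ∧ not (isPair c d i j)) ∨ p) ∨ q)
             (isPair-swap a c i j) (isPair-swap b d i j) ⟩
      (((adj G i j ∧ not (isPair a b i j)) ∧ not (isPair c d i j)) ∨ isPair c a i j) ∨ isPair d b i j
        ≡⟨ cong (λ x → (x ∨ isPair c a i j) ∨ isPair d b i j)
             (lemma (adj G i j) (isPair a b i j) (isPair c d i j)) ⟩
      (((adj G i j ∧ not (isPair c d i j)) ∧ not (isPair a b i j)) ∨ isPair c a i j) ∨ isPair d b i j
        ∎))
    where
    open ≡-Reasoning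
    lemma : ∀ x y z → (x ∧ not y) ∧ not z ≡ (x ∧ not z) ∧ not y
    lemma false _ _ = refl
    lemma true  y z = ∧-comm (not y) (not z)

  -- The transposed matrix undoes the switch. As the four vertices are distinct, neither inserted
  -- edge restores `a b` or `c d`.
  swap-sym : Swap (matrix a c b d) H G
  swap-sym with ((ab , cd) , (a≢c , a≢d , b≢c , b≢d) , ac , bd) ← interchangeable σ = mkSwap
    ( (swap-new₁ , swap-new₂)
    , (a≢b , a≢d , b≢c ∘ sym , c≢d)
    , ¬ab a≢d b≢c , ¬cd a≢d b≢c )
    (λ i j → trans
      (lemma (adj G i j) (isPair a b i j) (isPair c d i j) (isPair a c i j) (isPair b d i j)
        (λ p → pair-edge G (isPair⁻ p) ab) (λ p → pair-edge G (isPair⁻ p) cd)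
        (λ p e → ac (pair-edge⁻ G (isPair⁻ p) e)) (λ p e → bd (pair-edge⁻ G (isPair⁻ p) e)))
      (cong (λ e → (((e ∧ not (isPair a c i j)) ∧ not (isPair b d i j)) ∨ isPair a b i j) ∨ isPair c d i j)
        (sym (result σ i j))))
    where
    a≢b : a ≢ b
    a≢b = edge⇒≢ G (proj₁ (proj₁ (interchangeable σ)))
    c≢d : c ≢ d
    c≢d = edge⇒≢ G (proj₂ (proj₁ (interchangeable σ)))

    ¬ab : a ≢ d → b ≢ c → ¬ Edge H a b
    ¬ab a≢d b≢c ab with swap⁻ ab
    ... | inj₁ (_ , ¬p , _)            = ¬p (inj₁ (refl , refl))
    ... | inj₂ (inj₁ (inj₁ (_ , b≡c))) = b≢c b≡c
    ... | inj₂ (inj₁ (inj₂ (b≡a , _))) = a≢b (sym b≡a)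
    ... | inj₂ (inj₂ (inj₁ (a≡b , _))) = a≢b a≡b
    ... | inj₂ (inj₂ (inj₂ (_ , a≡d))) = a≢d a≡d

    ¬cd : a ≢ d → b ≢ c → ¬ Edge H c d
    ¬cd a≢d b≢c cd with swap⁻ cd
    ... | inj₁ (_ , _ , ¬p)            = ¬p (inj₁ (refl , refl))
    ... | inj₂ (inj₁ (inj₁ (_ , d≡c))) = c≢d (sym d≡c)
    ... | inj₂ (inj₁ (inj₂ (d≡a , _))) = a≢d (sym d≡a)
    ... | inj₂ (inj₂ (inj₁ (c≡b , _))) = b≢c (sym c≡b)
    ... | inj₂ (inj₂ (inj₂ (_ , c≡d))) = c≢d c≡d

    lemma : ∀ e p q r s → (p ≡ true → e ≡ true) → (q ≡ true → e ≡ true) →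
            (r ≡ true → ¬ (e ≡ true)) → (s ≡ true → ¬ (e ≡ true)) →
            e ≡ (((((((e ∧ not p) ∧ not q) ∨ r) ∨ s) ∧ not r) ∧ not s) ∨ p) ∨ q
    lemma true  p     q     true  s     _ _ h _ = contradiction refl (h refl)
    lemma true  p     q     false true  _ _ _ h = contradiction refl (h refl)
    lemma true  true  q     false false _ _ _ _ = refl
    lemma true  false true  false false _ _ _ _ = refl
    lemma true  false false false false _ _ _ _ = refl
    lemma false true  q     r     s     h _ _ _ = contradiction (h refl) λ ()
    lemma false false true  r     s     _ h _ _ = contradiction (h refl) λ ()
    lemma false false false true  s     _ _ _ _ = refl
    lemma false false false false true  _ _ _ _ = refl
    lemma false false false false false _ _ _ _ = refl

  -- At `a` the neighbour `b` is exchanged for `c`; every other neighbour survives.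
  swap-degree-a : degree G a ≤ degree H a
  swap-degree-a with ((ab , cd) , (a≢c , a≢d , b≢c , b≢d) , ac , bd) ← interchangeable σ =
    subst₂ _≤_ (sym (count-∖ {p = adj G a} ab)) (sym (count-∖ {p = adj H a} swap-new₁))
      (s≤s (count-mono {p = adj G a ∖ b} {adj H a ∖ c} λ j e →
        let aj , j≢b = ∖⁻ (adj G a) e in
        ∖⁺ (adj H a)
          (swap-keep aj
            (λ { (inj₁ (_ , j≡b)) → j≢b j≡b ; (inj₂ (_ , a≡b)) → edge⇒≢ G ab a≡b })
            (λ { (inj₁ (a≡c , _)) → a≢c a≡c ; (inj₂ (_ , a≡d)) → a≢d a≡d }))
          λ { refl → ac aj }))

swap-off : ∀ {G H : Graph n} {a b c d i} → Swap (matrix a b c d) G H →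
           i ≢ a → i ≢ b → i ≢ c → i ≢ d → ∀ j → adj G i j ≡ adj H i j
swap-off {G = G} {H} {a} {b} {c} {d} {i} σ i≢a i≢b i≢c i≢d j = ⇔⇒≡
  (λ ij → swap-keep σ ij (avoid i≢a i≢b) (avoid i≢c i≢d))
  (λ ij → [ proj₁ , ⊥-elim ∘ [ avoid i≢a i≢c , avoid i≢b i≢d ]′ ]′ (swap⁻ σ ij))
  where
  avoid : ∀ {x y} → i ≢ x → i ≢ y → ¬ Pair x y i j
  avoid i≢x i≢y (inj₁ (i≡x , _)) = i≢x i≡x
  avoid i≢x i≢y (inj₂ (_ , i≡y)) = i≢y i≡y

swap-degree-≤ : ∀ {A : Matrix n} {G H} → Swap A G H → ∀ i → degree G i ≤ degree H i
swap-degree-≤ {A = matrix a b c d} {G} {H} σ i with i ≟ a | i ≟ b | i ≟ c | i ≟ d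
... | yes refl | _        | _        | _        = swap-degree-a σ
... | no _     | yes refl | _        | _        = swap-degree-a (swap-flip σ)
... | no _     | no _     | yes refl | _        = swap-degree-a (swap-turn σ)
... | no _     | no _     | no _     | yes refl = swap-degree-a (swap-flip (swap-turn σ))
... | no i≢a   | no i≢b   | no i≢c   | no i≢d   = 
  ≤-reflexive (count-cong {p = adj G i} (swap-off σ i≢a i≢b i≢c i≢d))

-- The inverse switch yields the opposite inequality.
swap-degree : ∀ {A : Matrix n} {G H} → Swap A G H → ∀ i → degree G i ≡ degree H i
swap-degree {A = matrix a b c d} σ i = ≤-antisym (swap-degree-≤ σ i) (swap-degree-≤ (swap-sym σ) i)

Isolated : Fin n → Graph n → Set
Isolated l G = ∀ j → ¬ Edge G l j

-- Each entry of the matrix is incident with an edge of `G`, so none of them is `l`; hence the pair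
-- `l z` is none of the four pairs involved, and inserting it commutes with the switch.
swap-insertEdge : ∀ {A : Matrix n} {G H l z} (l≢z : l ≢ z) → Isolated l G → Swap A G H →
                  Isolated l H × Swap A (insertEdge l z l≢z G) (insertEdge l z l≢z H)
swap-insertEdge {A = matrix a b c d} {G} {H} {l} {z} l≢z iso
  σ@(mkSwap ((ab , cd) , ≢s@(a≢c , a≢d , b≢c , b≢d) , ac , bd) res) =
  isolated ,
  mkSwap ((∨⁺ˡ ab , ∨⁺ˡ cd) , ≢s , ([ ac , avoid a≢l c≢l ]′ ∘ insertEdge⁻ G {a≢b = l≢z})
                                 , ([ bd , avoid b≢l d≢l ]′ ∘ insertEdge⁻ G {a≢b = l≢z}))
    λ i j → trans (cong (_∨ isPair l z i j) (res i j))
      (lemma (adj G i j) (isPair a b i j) (isPair c d i j) (isPair a c i j) (isPair b d i j) (isPair l z i j)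
        (λ p q → avoid a≢l b≢l (transfer (isPair⁻ {i = i} {j} p) (isPair⁻ {i = i} {j} q)))
        (λ p q → avoid c≢l d≢l (transfer (isPair⁻ {i = i} {j} p) (isPair⁻ {i = i} {j} q))))
  where
  a≢l : a ≢ l
  a≢l refl = iso b ab
  b≢l : b ≢ l
  b≢l refl = iso a (edge-sym G ab)
  c≢l : c ≢ l
  c≢l refl = iso d cd
  d≢l : d ≢ l
  d≢l refl = iso c (edge-sym G cd)

  avoid : ∀ {x y} → x ≢ l → y ≢ l → ¬ Pair l z x y
  avoid x≢l y≢l (inj₁ (x≡l , _)) = x≢l x≡l
  avoid x≢l y≢l (inj₂ (y≡l , _)) = y≢l y≡l

  transfer : ∀ {x y i j} → Pair x y i j → Pair l z i j → Pair l z x y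
  transfer (inj₁ (refl , refl)) lz = lz
  transfer (inj₂ (refl , refl)) lz = pair-sym lz

  isolated : Isolated l H
  isolated j lj with swap⁻ σ lj
  ... | inj₁ (e , _)                    = iso j e
  ... | inj₂ (inj₁ (inj₁ (l≡a , _)))    = a≢l (sym l≡a)
  ... | inj₂ (inj₁ (inj₂ (_ , l≡c)))    = c≢l (sym l≡c)
  ... | inj₂ (inj₂ (inj₁ (l≡b , _)))    = b≢l (sym l≡b)
  ... | inj₂ (inj₂ (inj₂ (_ , l≡d)))    = d≢l (sym l≡d)

  lemma : ∀ e p q r s t → (p ≡ true → ¬ (t ≡ true)) → (q ≡ true → ¬ (t ≡ true)) →
          ((((e ∧ not p) ∧ not q) ∨ r) ∨ s) ∨ t ≡ ((((e ∨ t) ∧ not p) ∧ not q) ∨ r) ∨ s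
  lemma e     p     q     r s false _ _ rewrite ∨-identityʳ e = ∨-identityʳ _
  lemma e     true  q     r s true  h _ = contradiction refl (h refl)
  lemma e     false true  r s true  _ h = contradiction refl (h refl)
  lemma true  false false r s true  _ _ = refl
  lemma false false false r s true  _ _ = ∨-zeroʳ _

-- Pseudoforests and functional graphs

consecutive : X → List X → List (X × X)
consecutive x []       = []
consecutive x (y ∷ ys) = (x , y) ∷ consecutive y ys

-- With `z = x` this opens a cycle into a closed walk starting and ending at `x`, which allows
-- recursion along it.
zip-consecutive : ∀ (x : X) ys z → zip (x ∷ ys) (ys ∷ʳ z) ≡ consecutive x (ys ∷ʳ z)
zip-consecutive x []       z = refl
zip-consecutive x (y ∷ ys) z = cong ((x , y) ∷_) (zip-consecutive y ys z)

headOr : X → List X → X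
headOr z []      = z
headOr z (y ∷ _) = y

∈-∷ʳ⁻ : ∀ {x z : X} ys → x ∈ˡ ys ∷ʳ z → x ∈ˡ z ∷ ys
∈-∷ʳ⁻ ys x∈ with ∈-++⁻ ys x∈
... | inj₁ x∈ys        = there x∈ys
... | inj₂ (here refl) = here refl

consecutive-∈ : ∀ {a b x : X} ys → (a , b) ∈ˡ consecutive x ys → a ∈ˡ x ∷ ys × b ∈ˡ ys
consecutive-∈ (y ∷ ys) (here refl) = here refl , here refl
consecutive-∈ (y ∷ ys) (there ab∈) =
  let a∈ , b∈ = consecutive-∈ ys ab∈ in there a∈ , there b∈

Unique-∷ʳ : ∀ {x : X} {ys} → Unique (x ∷ ys) → Unique (ys ∷ʳ x)
Unique-∷ʳ {ys = []}     _                           = [] ∷ []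
Unique-∷ʳ {ys = y ∷ ys} ((x≢y ∷ x∉) ∷ (y∉ ∷ unique)) = ∷ʳ⁺ y∉ (x≢y ∘ sym) ∷ Unique-∷ʳ (x∉ ∷ unique)

Unique-≢head : ∀ {x z : X} ys → All (x ≢_) (ys ∷ʳ z) → x ≢ headOr z ys
Unique-≢head []      (x≢z ∷ _) = x≢z
Unique-≢head (_ ∷ _) (x≢y ∷ _) = x≢y

-- Uniqueness leaves out the start `x`, because on a cycle it coincides with the end `z`.
interior-neighbours : ∀ {x y z i : X} ys → x ≢ headOr z ys → Unique (y ∷ ys ∷ʳ z) → i ∈ˡ y ∷ ys →
  ∃₂ λ p s → p ≢ s × (p , i) ∈ˡ consecutive x (y ∷ ys ∷ʳ z) × (i , s) ∈ˡ consecutive x (y ∷ ys ∷ʳ z)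
interior-neighbours {x = x} {z = z} []       x≢z _ (here refl) =
  x , z , x≢z , here refl , there (here refl)
interior-neighbours {x = x}         (y′ ∷ _) x≢y′ _ (here refl) =
  x , y′ , x≢y′ , here refl , there (here refl)
interior-neighbours (y′ ∷ ys) _ ((_ ∷ y∉) ∷ unique) (there i∈) =
  let p , s , p≢s , pi , is = interior-neighbours ys (Unique-≢head ys y∉) unique i∈
  in p , s , p≢s , there pi , there is

last-pair : ∀ (x : X) ys z → ∃ λ t → t ∈ˡ x ∷ ys × (t , z) ∈ˡ consecutive x (ys ∷ʳ z)
last-pair x []       z = x , here refl , here refl
last-pair x (y ∷ ys) z = let t , t∈ , tz = last-pair y ys z in t , there t∈ , there tz

cycle-neighbours : ∀ {xs : List X} {i} → 3 ≤ length xs → Unique xs → i ∈ˡ xs →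
  ∃₂ λ p s → p ≢ s × (p , i) ∈ˡ cyclicPairs xs × (i , s) ∈ˡ cyclicPairs xs
cycle-neighbours {xs = _ ∷ []} (s≤s ())
cycle-neighbours {xs = _ ∷ _ ∷ []} (s≤s (s≤s ()))
cycle-neighbours {xs = x ∷ y ∷ z ∷ ws} _ (_ ∷ (y∉ ∷ _)) (here refl)
  rewrite zip-consecutive z ws x =
  -- The first vertex of the list is preceded by the last one, which lies in `z ∷ ws` and so differs
  -- from the successor `y`.
  let t , t∈ , tx = last-pair z ws x
  in t , y , (λ t≡y → All.lookup y∉ t∈ (sym t≡y)) , there (there tx) , here refl
cycle-neighbours {xs = x ∷ y ∷ z ∷ ws} _ unique@((_ ∷ (x≢z ∷ _)) ∷ _) (there i∈)
  rewrite zip-consecutive z ws x = interior-neighbours (z ∷ ws) x≢z (Unique-∷ʳ unique) i∈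

cyclicPairs-∈ : ∀ {xs : List X} {a b} → (a , b) ∈ˡ cyclicPairs xs → a ∈ˡ xs × b ∈ˡ xs
cyclicPairs-∈ {xs = x ∷ xs} ab∈ rewrite zip-consecutive x xs x
  with consecutive-∈ (xs ∷ʳ x) ab∈
... | here refl , b∈ = here refl , ∈-∷ʳ⁻ xs b∈
... | there a∈  , b∈ = ∈-∷ʳ⁻ xs a∈ , ∈-∷ʳ⁻ xs b∈

module _ {R : Rel X 0ℓ} where

  reach-from-head : ∀ {x y} ys → All (uncurry R) (consecutive x ys) → y ∈ˡ x ∷ ys → Star R x y
  reach-from-head ys       _           (here refl) = ε
  reach-from-head (y ∷ ys) (xy ∷ rest) (there y∈)  = xy ◅ reach-from-head ys rest y∈

  reach-last : ∀ {x y z} ys → All (uncurry R) (consecutive x (ys ∷ʳ z)) → y ∈ˡ x ∷ ys → Star R y z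
  reach-last []       (xz ∷ _)    (here refl) = xz ◅ ε
  reach-last (y ∷ ys) (xy ∷ rest) (here refl) = xy ◅ reach-last ys rest (here refl)
  reach-last (y ∷ ys) (_ ∷ rest)  (there y∈)  = reach-last ys rest y∈

  cycle-reach : ∀ {xs y z} → All (uncurry R) (cyclicPairs xs) → y ∈ˡ xs → z ∈ˡ xs → Star R y z
  cycle-reach {x ∷ xs} closed y∈ z∈ rewrite zip-consecutive x xs x =
    reach-last xs closed y∈ ◅◅ reach-from-head (xs ∷ʳ x) closed (weaken z∈)
    where
    weaken : ∀ {z} → z ∈ˡ x ∷ xs → z ∈ˡ x ∷ xs ∷ʳ x
    weaken (here refl) = here refl
    weaken (there z∈)  = there (∈-++⁺ˡ z∈)

cycleEdge⇒edge : ∀ {G : Graph n} (C : Cycle G) {i j} → CycleEdge C i j → Edge G i j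
cycleEdge⇒edge {G = G} C (inj₁ ij∈) = All.lookup (closed C) ij∈
cycleEdge⇒edge {G = G} C (inj₂ ji∈) = edge-sym G (All.lookup (closed C) ji∈)

cycleEdge-∈ : ∀ {G : Graph n} (C : Cycle G) {i j} → CycleEdge C i j → i ∈ˡ vertices C
cycleEdge-∈ C (inj₁ ij∈) = proj₁ (cyclicPairs-∈ ij∈)
cycleEdge-∈ C (inj₂ ji∈) = proj₂ (cyclicPairs-∈ ji∈)

cycle-vertex : ∀ {G : Graph n} (C : Cycle G) → ∃ λ x → x ∈ˡ vertices C
cycle-vertex record { vertices = [] ; long = () }
cycle-vertex record { vertices = x ∷ _ } = x , here refl

connected-sym : ∀ (G : Graph n) {i j} → Connected G i j → Connected G j i
connected-sym G = Star.reverse (edge-sym G)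

-- Cycles in graphs of maximum degree two

module _ {n} {G : Graph n} (deg≤2 : ∀ i → degree G i ≤ 2) where

  private
    -- The two neighbours of `i` on the cycle use up its degree. Hence a cycle fills its whole
    -- component.
    edge⇒cycleEdge : ∀ (C : Cycle G) {i j} → i ∈ˡ vertices C → Edge G i j → CycleEdge C i j
    edge⇒cycleEdge C {i} {j} i∈ ij
      with p , s , p≢s , pi , is ← cycle-neighbours (long C) (distinct C) i∈
      with j ≟ p | j ≟ s
    ... | yes refl | _        = inj₂ pi
    ... | no _     | yes refl = inj₁ is
    ... | no j≢p   | no j≢s   = contradiction (deg≤2 i) (<⇒≱ (begin
      3                                ≤⟨ s≤s (s≤s (s≤s z≤n)) ⟩
      3 + count (adj G i ∖ j ∖ p ∖ s)  ≡⟨ cong (2 +_) (sym (count-∖ {p = adj G i ∖ j ∖ p} is∈)) ⟩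
      2 + count (adj G i ∖ j ∖ p)      ≡⟨ cong suc (sym (count-∖ {p = adj G i ∖ j} pi∈)) ⟩
      1 + count (adj G i ∖ j)          ≡⟨ sym (count-∖ {p = adj G i} ij) ⟩
      degree G i                       ∎))
      where
      open ≤-Reasoning
      pi∈ : (adj G i ∖ j) p ≡ true
      pi∈ = ∖⁺ (adj G i) (edge-sym G (All.lookup (closed C) pi)) (j≢p ∘ sym)
      is∈ : (adj G i ∖ j ∖ p) s ≡ true
      is∈ = ∖⁺ (adj G i ∖ j) (∖⁺ (adj G i) (All.lookup (closed C) is) (j≢s ∘ sym)) (p≢s ∘ sym)

    connected-∈ : ∀ (C : Cycle G) {i j} → i ∈ˡ vertices C → Connected G i j → j ∈ˡ vertices C
    connected-∈ C i∈ ε          = i∈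
    connected-∈ C i∈ (ik ◅ k~j) =
      connected-∈ C (cycleEdge-∈ C (swap (edge⇒cycleEdge C i∈ ik))) k~j

    transfer : ∀ {v} (C D : Cycle G) → InComponentOf v C → InComponentOf v D →
               ∀ {i j} → CycleEdge C i j → CycleEdge D i j
    transfer C D v~C v~D ij = edge⇒cycleEdge D
      (let x , x∈ = cycle-vertex D
       in connected-∈ D x∈ (connected-sym G (All.lookup v~D x∈) ◅◅ All.lookup v~C (cycleEdge-∈ C ij)))
      (cycleEdge⇒edge C ij)

  degree≤2⇒pseudoforest : Pseudoforest G
  degree≤2⇒pseudoforest v C D v~C v~D i j = mk⇔ (transfer C D v~C v~D) (transfer D C v~D v~C)

-- Graphs covered by a self-map are pseudoforests

Covers : (Fin n → Fin n) → Graph n → Set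
Covers f G = ∀ {i j} → Edge G i j → f i ≡ j ⊎ f j ≡ i

Functional : Graph n → Set
Functional {n} G = ∃ λ (f : Fin n → Fin n) → Covers f G

Orbit : (Fin n → Fin n) → Fin n → Fin n → Set
Orbit f = Star (λ x y → f x ≡ y)

module _ {n} {G : Graph n} {f : Fin n → Fin n} (covers : Covers f G) where

  private
    forward-head : ∀ {y z} ys → All (λ (a , b) → f a ≡ b) (consecutive y (ys ∷ʳ z)) → f y ≡ headOr z ys
    forward-head []      (fy≡z ∷ _) = fy≡z
    forward-head (_ ∷ _) (fy≡y ∷ _) = fy≡y

    -- A vertex has only one value: if the rest of the path points forward, its first vertex cannot
    -- also cover the edge before it. Otherwise the end `z` already points back into the path.
    forward⊎backward-end : ∀ {x z} ys → Unique (x ∷ ys ∷ʳ z) →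
      All (uncurry (Edge G)) (consecutive x (ys ∷ʳ z)) →
      All (λ (a , b) → f a ≡ b) (consecutive x (ys ∷ʳ z)) ⊎ ∃ λ t → t ∈ˡ x ∷ ys × f z ≡ t
    forward⊎backward-end {x} [] _ (xz ∷ []) with covers xz
    ... | inj₁ fx≡z = inj₁ (fx≡z ∷ [])
    ... | inj₂ fz≡x = inj₂ (x , here refl , fz≡x)
    forward⊎backward-end {x} (y ∷ ys) ((_ ∷ x∉) ∷ unique) (xy ∷ rest)
      with forward⊎backward-end ys unique rest
    ... | inj₂ (t , t∈ , fz≡t) = inj₂ (t , there t∈ , fz≡t)
    ... | inj₁ fwd with covers xy
    ...   | inj₁ fx≡y = inj₁ (fx≡y ∷ fwd)
    ...   | inj₂ fy≡x = contradiction (trans (sym fy≡x) (forward-head ys fwd)) (Unique-≢head ys x∉)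

    -- The value of `y` is spent on `w`, so the next edge has to be covered from its far end.
    backward-propagates : ∀ {w y} ys → Unique (w ∷ y ∷ ys) → f y ≡ w →
      All (uncurry (Edge G)) (consecutive y ys) → All (λ (a , b) → f b ≡ a) (consecutive y ys)
    backward-propagates [] _ _ _ = []
    backward-propagates (y′ ∷ ys) ((_ ∷ (w≢y′ ∷ _)) ∷ unique) fy≡w (yy′ ∷ rest) with covers yy′
    ... | inj₁ fy≡y′ = contradiction (trans (sym fy≡w) fy≡y′) w≢y′
    ... | inj₂ fy′≡y = fy′≡y ∷ backward-propagates ys unique fy′≡y rest

  -- The stretch from `z` back to `x` decides. If it points forward, the values of `z` and then of
  -- `y` are spent, which forces the first two edges forward. If `x` points into it, then `f x` is
  -- not `y`, and all edges are forced backward one after another.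
  cycle-oriented : ∀ {xs} → 3 ≤ length xs → Unique xs → All (uncurry (Edge G)) (cyclicPairs xs) →
    All (λ (a , b) → f a ≡ b) (cyclicPairs xs) ⊎ All (λ (a , b) → f b ≡ a) (cyclicPairs xs)
  cycle-oriented {_ ∷ []} (s≤s ())
  cycle-oriented {_ ∷ _ ∷ []} (s≤s (s≤s ()))
  cycle-oriented {x ∷ y ∷ z ∷ ws} _ unique@((x≢y ∷ (x≢z ∷ _)) ∷ (y∉ ∷ _)) (xy ∷ yz ∷ rest)
    rewrite zip-consecutive z ws x
    with unique′@((_ ∷ y∉′) ∷ unique″) ← Unique-∷ʳ unique
    with forward⊎backward-end ws unique″ rest
  ... | inj₁ fwd with covers yz | covers xy
  ...   | inj₂ fz≡y | _         = contradiction (trans (sym fz≡y) (forward-head ws fwd)) (Unique-≢head ws y∉′)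
  ...   | inj₁ fy≡z | inj₂ fy≡x = contradiction (trans (sym fy≡x) fy≡z) x≢z
  ...   | inj₁ fy≡z | inj₁ fx≡y = inj₁ (fx≡y ∷ fy≡z ∷ fwd)
  cycle-oriented {x ∷ y ∷ z ∷ ws} _ ((_ ∷ (x≢z ∷ _)) ∷ (y∉ ∷ _)) (xy ∷ yz ∷ rest)
      | inj₂ (t , t∈ , fx≡t) with covers xy | covers yz
  ...   | inj₁ fx≡y | _         = contradiction (trans (sym fx≡y) fx≡t) (All.lookup y∉ t∈)
  ...   | inj₂ fy≡x | inj₁ fy≡z = contradiction (trans (sym fy≡x) fy≡z) x≢z
  ...   | inj₂ fy≡x | inj₂ fz≡y = inj₂ (fy≡x ∷ fz≡y ∷ backward-propagates (ws ∷ʳ x) unique′ fz≡y rest)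

  private
    module Oriented (C : Cycle G) where

      oriented = cycle-oriented (long C) (distinct C) (closed C)

      orbit : ∀ {y z} → y ∈ˡ vertices C → z ∈ˡ vertices C → Orbit f y z
      orbit y∈ z∈ with oriented
      ... | inj₁ fwd = cycle-reach fwd y∈ z∈
      ... | inj₂ bwd = Star.reverse id (cycle-reach bwd z∈ y∈)

      image-edge : ∀ {y} → y ∈ˡ vertices C → CycleEdge C y (f y)
      image-edge y∈ with cycle-neighbours (long C) (distinct C) y∈ | oriented
      ... | p , s , _ , py , ys | inj₁ fwd rewrite All.lookup fwd ys = inj₁ ys
      ... | p , s , _ , py , ys | inj₂ bwd rewrite All.lookup bwd py = inj₂ py

      closed-orbit : ∀ {y z} → y ∈ˡ vertices C → Orbit f y z → z ∈ˡ vertices C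
      closed-orbit y∈ ε             = y∈
      closed-orbit y∈ (refl ◅ y⟶z) = closed-orbit (cycleEdge-∈ C (swap (image-edge y∈))) y⟶z

    -- Induction along the path. If the first edge is covered from `u`, the orbit of `u` gets one
    -- step longer; if from `u′`, the orbit of `u′` either passes through `u` at once or is trivial,
    -- and then the orbit of `v` continues to `u`.
    orbits-meet : ∀ {u v} → Connected G u v → ∃ λ w → Orbit f u w × Orbit f v w
    orbits-meet {u} ε = u , ε , ε
    orbits-meet {u} (_◅_ {j = u′} uu′ u′~v)
      with w , u′⟶w , v⟶w ← orbits-meet u′~v | covers uu′
    ... | inj₁ fu≡u′ = w , fu≡u′ ◅ u′⟶w , v⟶w
    ... | inj₂ fu′≡u with u′⟶w
    ...   | ε           = u , ε , v⟶w ◅◅ (fu′≡u ◅ ε)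
    ...   | refl ◅ u⟶w = w , subst (λ x → Orbit f x w) fu′≡u u⟶w , v⟶w

    -- Cycles are closed under `f`, so a common point of orbits started on `C` and on `D` lies on
    -- both. From it `f` runs through all of `C` without leaving `D`, and every edge of `C` joins
    -- some `k` to `f k`.
    transfer : ∀ {v} (C D : Cycle G) → InComponentOf v C → InComponentOf v D →
               ∀ {i j} → CycleEdge C i j → CycleEdge D i j
    transfer C D v~C v~D {i} {j} ij
      with x , x∈C ← cycle-vertex C | y , y∈D ← cycle-vertex D
      with w , x⟶w , y⟶w ← orbits-meet (connected-sym G (All.lookup v~C x∈C) ◅◅ All.lookup v~D y∈D)
      = by-cases (covers (cycleEdge⇒edge C ij))
      where
      C⊆D : ∀ {k} → k ∈ˡ vertices C → k ∈ˡ vertices D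
      C⊆D k∈C = Oriented.closed-orbit D (Oriented.closed-orbit D y∈D y⟶w)
        (Oriented.orbit C (Oriented.closed-orbit C x∈C x⟶w) k∈C)

      by-cases : f i ≡ j ⊎ f j ≡ i → CycleEdge D i j
      by-cases (inj₁ refl) = Oriented.image-edge D (C⊆D (cycleEdge-∈ C ij))
      by-cases (inj₂ refl) = swap (Oriented.image-edge D (C⊆D (cycleEdge-∈ C (swap ij))))

  covers⇒pseudoforest : Pseudoforest G
  covers⇒pseudoforest v C D v~C v~D i j = mk⇔ (transfer C D v~C v~D) (transfer D C v~D v~C)

-- Changing an orientation at single vertices

infix 8 _[_↦_]

_[_↦_] : (Fin n → X) → Fin n → X → Fin n → X
(f [ a ↦ b ]) i = if does (i ≟ a) then b else f i

update-≡ : ∀ (f : Fin n → X) a {b} → (f [ a ↦ b ]) a ≡ b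
update-≡ f a with a ≟ a
... | yes _  = refl
... | no a≢a = contradiction refl a≢a

update-≢ : ∀ (f : Fin n → X) {a b i} → i ≢ a → (f [ a ↦ b ]) i ≡ f i
update-≢ f {a} {i = i} i≢a with i ≟ a
... | yes i≡a = contradiction i≡a i≢a
... | no _    = refl

Covered : (Fin n → Fin n) → Fin n → Fin n → Set
Covered f i j = f i ≡ j ⊎ f j ≡ i

covered-pair : ∀ {f : Fin n → Fin n} {a b i j} → Pair a b i j → f a ≡ b → Covered f i j
covered-pair (inj₁ (refl , refl)) fa≡b = inj₁ fa≡b
covered-pair (inj₂ (refl , refl)) fa≡b = inj₂ fa≡b

update-covered : ∀ (f : Fin n → Fin n) {a b i j} → Covered f i j →
                 Covered (f [ a ↦ b ]) i j ⊎ Pair a (f a) i j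
update-covered f {a} {i = i} {j} (inj₁ fi≡j) with i ≟ a
... | yes refl = inj₂ (inj₁ (refl , sym fi≡j))
... | no _     = inj₁ (inj₁ fi≡j)
update-covered f {a} {i = i} {j} (inj₂ fj≡i) with j ≟ a
... | yes refl = inj₂ (inj₂ (refl , sym fj≡i))
... | no _     = inj₁ (inj₂ fj≡i)

pair-≢ : ∀ {a i j : Fin n} → i ≢ j → ¬ Pair a a i j
pair-≢ i≢j (inj₁ (refl , refl)) = i≢j refl
pair-≢ i≢j (inj₂ (refl , refl)) = i≢j refl

-- `Covers` lets values point to nonneighbours. Here a vertex without outgoing edge is a fixed
-- point, and so an orbit stays within a component.
Sound : (Fin n → Fin n) → Graph n → Set
Sound f G = ∀ i → f i ≢ i → Edge G i (f i)

soundCover : ∀ {G : Graph n} → Functional G → ∃ λ f → Covers f G × Sound f G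
soundCover {n} {G} (f , covers) = g , g-covers , g-sound
  where
  g : Fin n → Fin n
  g i = if adj G i (f i) then f i else i

  g-edge : ∀ {i j} → Edge G i j → f i ≡ j → g i ≡ j
  g-edge {i} ij refl rewrite ij = refl

  g-covers : Covers g G
  g-covers ij with covers ij
  ... | inj₁ fi≡j = inj₁ (g-edge ij fi≡j)
  ... | inj₂ fj≡i = inj₂ (g-edge (edge-sym G ij) fj≡i)

  g-sound : Sound g G
  g-sound i gi≢i with adj G i (f i) in eq
  ... | true  = eq
  ... | false = contradiction refl gi≢i

module _ {n} {G : Graph n} {f : Fin n → Fin n} (covers : Covers f G) (sound : Sound f G) where

  -- Reverses the orbit of a up to r; a 2-cycle r ⇄ f r stands for a single edge
  -- and may therefore be cut open at r.
  reroot : ∀ {a r} → Orbit f a r → f (f r) ≡ r → ∃ λ g → Covers g G × g a ≡ a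
  reroot {r = r} ε ffr≡r = f [ r ↦ r ] , cover , update-≡ f r
    where
    cover : Covers (f [ r ↦ r ]) G
    cover {i} {j} ij with update-covered f {r} {r} (covers ij)
    ... | inj₁ cov = cov
    ... | inj₂ p   = covered-pair (pair-swap p) (trans (update-≢ f fr≢r) ffr≡r)
      where
      fr≢r : f r ≢ r
      fr≢r fr≡r = pair-≢ (edge⇒≢ G ij) (subst (λ x → Pair r x i j) fr≡r p)
  reroot {a} (refl ◅ fa⟶r) ffr≡r with g , g-covers , gb≡b ← reroot fa⟶r ffr≡r | f a ≟ a
  ... | yes fa≡a = g , g-covers , subst (λ x → g x ≡ x) fa≡a gb≡b
  ... | no fa≢a  = h , cover , update-≡ g′ a
    where
    b = f a
    -- As `g` fixes `b`, the edge between `a` and `b` is covered by `g a`. Now `b` takes it over,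
    -- and `a` becomes free.
    g′ = g [ b ↦ a ]
    h = g′ [ a ↦ a ]

    ga≡b : g a ≡ b
    ga≡b with g-covers (sound a fa≢a)
    ... | inj₁ ga≡b = ga≡b
    ... | inj₂ gb≡a = contradiction (trans (sym gb≡b) gb≡a) fa≢a

    cover : Covers h G
    cover {i} {j} ij with update-covered g {b} {a} (g-covers ij)
    ... | inj₂ p = contradiction (subst (λ x → Pair b x i j) gb≡b p) (pair-≢ (edge⇒≢ G ij))
    ... | inj₁ cov with update-covered g′ {a} {a} cov
    ...   | inj₁ cov′ = cov′
    ...   | inj₂ p    = covered-pair
      (subst (λ x → Pair x a i j) (trans (update-≢ g (fa≢a ∘ sym)) ga≡b) (pair-swap p))
      (trans (update-≢ g′ fa≢a) (update-≡ g b))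

-- From orbits to cycles of the graph

orbit-iterate : ∀ (f : Fin n → Fin n) a k → Orbit f a (iterate f a k)
orbit-iterate f a zero    = ε
orbit-iterate f a (suc k) = refl ◅ orbit-iterate f (f a) k

orbit-later : ∀ (f : Fin n → Fin n) a {i j} → i < j → Orbit f (f (iterate f a i)) (iterate f a j)
orbit-later f a {zero}  {suc j} _         = orbit-iterate f (f a) j
orbit-later f a {suc i} {suc j} (s≤s i<j) = orbit-later f (f a) i<j

-- Among `n + 1` iterates two coincide, so the orbit reaches a periodic point. Period one or two
-- gives no cycle of the graph and allows `reroot`; a longer period does give one.
orbit-end : ∀ (f : Fin n → Fin n) a →
  (∃ λ r → Orbit f a r × f (f r) ≡ r) ⊎ (∃ λ c → Orbit f a c × f (f c) ≢ c × Orbit f (f c) c)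
orbit-end {n} f a
  with i , j , i<j , fⁱa≡fʲa ← pigeonhole (n<1+n n) (λ i → iterate f a (toℕ i))
  with c ← iterate f a (toℕ i) in eq
  with f (f c) ≟ c
... | yes ffc≡c = inj₁ (c , subst (Orbit f a) eq (orbit-iterate f a (toℕ i)) , ffc≡c)
... | no ffc≢c  = inj₂ (c , subst (Orbit f a) eq (orbit-iterate f a (toℕ i)) , ffc≢c ,
  subst₂ (λ x y → Orbit f (f x) y) eq (sym fⁱa≡fʲa) (orbit-later f a i<j))

-- Unlike `Star`, it exposes the vertices after the first, so that the absence of repetitions can be
-- stated.
data Path {X : Set} (R : Rel X 0ℓ) (z : X) : X → List X → Set where
  stop : Path R z z []
  _∷_  : ∀ {x y ys} → R x y → Path R z y ys → Path R z x (y ∷ ys)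

path-from : ∀ {R : Rel X 0ℓ} {x y z ys} → x ∈ˡ y ∷ ys → Path R z y ys → Unique (y ∷ ys) →
            ∃ λ xs → Path R z x xs × Unique (x ∷ xs)
path-from (here refl) p       u       = _ , p , u
path-from (there x∈)  (_ ∷ p) (_ ∷ u) = path-from x∈ p u

private
  module Membership {n : ℕ} where
    open DecMembership (_≟_ {n}) using (_∈?_) public

open Membership

-- If `x` already occurs on the simple path from its successor, the detour before that occurrence is
-- cut off.
simplePath : ∀ {R : Rel (Fin n) 0ℓ} {x z} → Star R x z → ∃ λ xs → Path R z x xs × Unique (x ∷ xs)
simplePath ε = [] , stop , [] ∷ []
simplePath {x = x} (_◅_ {j = y} xy y⟶z)
  with ys , p , u ← simplePath y⟶z
  with x ∈? (y ∷ ys)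
... | yes x∈ = path-from x∈ p u
... | no x∉  = y ∷ ys , xy ∷ p , ¬Any⇒All¬ _ x∉ ∷ u

path-closes : ∀ {R S : Rel X 0ℓ} {x y z xs} → (∀ {a b} → a ≢ b → R a b → S a b) →
              Path R z x xs → Unique (x ∷ xs) → S z y → All (uncurry S) (consecutive x (xs ∷ʳ y))
path-closes R⇒S stop      _               zy = zy ∷ []
path-closes R⇒S (xy ∷ p) ((x≢y ∷ _) ∷ u) zy = R⇒S x≢y xy ∷ path-closes R⇒S p u zy

path-end-pair : ∀ {R : Rel X 0ℓ} {x y z xs} → Path R z x xs → (z , y) ∈ˡ consecutive x (xs ∷ʳ y)
path-end-pair stop    = here refl
path-end-pair (_ ∷ p) = there (path-end-pair p)

-- The conditions `x ≢ z` and `¬ R x z` rule out paths with fewer than two steps, so the cycle has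
-- at least three vertices. Only distinct related vertices need be adjacent, which admits self-maps
-- with fixed points.
closePath : ∀ {G : Graph n} {R : Rel (Fin n) 0ℓ} {x z xs} → (∀ {a b} → a ≢ b → R a b → Edge G a b) →
            Path R z x xs → Unique (x ∷ xs) → x ≢ z → ¬ R x z → Edge G z x →
            ∃ λ (C : Cycle G) → CycleEdge C z x
closePath R⇒E stop           _ x≢z _   _  = contradiction refl x≢z
closePath R⇒E (xz ∷ stop)   _ _   ¬xz _  = contradiction xz ¬xz
closePath {n} {G} {x = x} {z} {xs} R⇒E p@(_ ∷ (_ ∷ _)) u _ _ zx = record
  { vertices = x ∷ xs
  ; long     = s≤s (s≤s (s≤s z≤n))
  ; distinct = u
  ; closed   = subst (All (uncurry (Edge G))) (sym (zip-consecutive x xs x)) (path-closes R⇒E p u zx)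
  } , inj₁ (subst ((z , x) ∈ˡ_) (sym (zip-consecutive x xs x)) (path-end-pair p))

cycle-connected : ∀ {G : Graph n} (C : Cycle G) {i j} → i ∈ˡ vertices C → j ∈ˡ vertices C → Connected G i j
cycle-connected C = cycle-reach (closed C)

orbit-connected : ∀ (G : Graph n) {f} → Sound f G → ∀ {x y} → Orbit f x y → Connected G x y
orbit-connected G sound ε = ε
orbit-connected G {f} sound {x} (refl ◅ y⟶z) with f x ≟ x
... | yes fx≡x = subst (λ w → Connected G w _) fx≡x (orbit-connected G sound y⟶z)
... | no fx≢x  = sound x fx≢x ◅ orbit-connected G sound y⟶z

orbitCycle : ∀ {G : Graph n} {f c} → Sound f G → f (f c) ≢ c → Orbit f (f c) c →
             ∃ λ (C : Cycle G) → c ∈ˡ vertices C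
orbitCycle {G = G} {f} {c} sound ffc≢c fc⟶c =
  let xs , p , u = simplePath fc⟶c
      C , e      = closePath {G = G} (λ { a≢b refl → sound _ (a≢b ∘ sym) }) p u fc≢c ffc≢c (sound c fc≢c)
  in C , cycleEdge-∈ C e
  where
  fc≢c : f c ≢ c
  fc≢c fc≡c = ffc≢c (trans (cong f fc≡c) fc≡c)

-- Pseudoforests are covered by a self-map

module _ {n} {G : Graph n} {a b} (pf : Pseudoforest G) (ab : Edge G a b) where

  private
    G₀ = deleteEdge a b G

    G₀⊑G : G₀ ⊑ G
    G₀⊑G = proj₁ ∘ deleteEdge⁻ G

    a≢b : a ≢ b
    a≢b = edge⇒≢ G ab

    ab∉G₀ : ¬ Edge G₀ a b
    ab∉G₀ e = proj₂ (deleteEdge⁻ G e) (inj₁ (refl , refl))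

    lift : Cycle G₀ → Cycle G
    lift C = record
      { vertices = vertices C ; long = long C ; distinct = distinct C
      ; closed   = All.map G₀⊑G (closed C) }

    component : ∀ {x v} (C : Cycle G) → Connected G v x → x ∈ˡ vertices C → InComponentOf v C
    component C v~x x∈ = All.tabulate λ y∈ → v~x ◅◅ cycle-connected C x∈ y∈

  -- In `G` both cycles lie in the component of `a`, so they coincide and join `a` to `b` inside
  -- `G₀`. A simple such path closes with the edge `a b` to a third cycle `E`, which must equal `C`
  -- as well, although `C` avoids that edge.
  no-two-cycles : ∀ {x y} (C D : Cycle G₀) → Connected G₀ a x → x ∈ˡ vertices C →
                  Connected G₀ b y → y ∈ˡ vertices D → ⊥
  no-two-cycles {x} {y} C D a~x x∈C b~y y∈D =
    ab∉G₀ (edge-sym G₀ (cycleEdge⇒edge C (Equivalence.from (pf a (lift C) E aC aE _ _) ba∈E)))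
    where
    aC : InComponentOf a (lift C)
    aC = component (lift C) (Star.map G₀⊑G a~x) x∈C

    aD : InComponentOf a (lift D)
    aD = component (lift D) (ab ◅ Star.map G₀⊑G b~y) y∈D

    x∈D : x ∈ˡ vertices D
    x∈D with p , s , _ , _ , xs ← cycle-neighbours (long C) (distinct C) x∈C =
      cycleEdge-∈ (lift D) (Equivalence.to (pf a (lift C) (lift D) aC aD x s) (inj₁ xs))

    path = simplePath (a~x ◅◅ cycle-connected D x∈D y∈D ◅◅ connected-sym G₀ b~y)

    closing = closePath {G = G} (λ _ → G₀⊑G) (proj₁ (proj₂ path)) (proj₂ (proj₂ path))
      a≢b ab∉G₀ (edge-sym G ab)
    E = proj₁ closing
    ba∈E = proj₂ closing

    aE : InComponentOf a E
    aE = component E ε (cycleEdge-∈ E (swap ba∈E))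

covers-insert : ∀ {G : Graph n} {f a b} → f a ≡ a → Covers f (deleteEdge a b G) → Covers (f [ a ↦ b ]) G
covers-insert {G = G} {f} {a} {b} fa≡a covers {i} {j} ij with isPair a b i j in eq
... | true  = covered-pair (isPair⁻ eq) (update-≡ f a)
... | false with update-covered f {a} {b} (covers (deleteEdge⁺ G ij
                   λ p → true≢false (trans (sym (isPair⁺ p)) eq)))
...   | inj₁ cov = cov
...   | inj₂ p   = contradiction (subst (λ x → Pair a x i j) fa≡a p) (pair-≢ (edge⇒≢ G ij))

-- Delete an edge `a b` and cover the rest. If the orbit of an endpoint ends in a fixed point or a
-- 2-cycle, rerooting frees that endpoint to cover the deleted edge. Otherwise both endpoints lead
-- to a cycle, against `no-two-cycles`.
pseudoforest⇒functional : ∀ {G : Graph n} m → size G ≤ m → Pseudoforest G → Functional G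
pseudoforest⇒functional {G = G} m size≤m pf with any? (λ a → any? (λ b → adj G a b Bool.≟ true))
... | no none = id , λ {i} {j} ij → contradiction (i , j , ij) none
pseudoforest⇒functional {G = G} zero size≤m pf | yes (a , b , ab) =
  contradiction (<-≤-trans (size-deleteEdge G ab) size≤m) λ ()
pseudoforest⇒functional {G = G} (suc m) size≤m pf | yes (a , b , ab)
  with f , covers , sound ← soundCover {G = deleteEdge a b G} (pseudoforest⇒functional {G = deleteEdge a b G} m
         (≤-pred (<-≤-trans (size-deleteEdge G ab) size≤m))
         (Pseudoforest-⊑ {G = deleteEdge a b G} (proj₁ ∘ deleteEdge⁻ G) pf))
  with orbit-end f a | orbit-end f b
... | inj₁ (r , a⟶r , root) | _ =
  let g , g-covers , ga≡a = reroot {G = deleteEdge a b G} covers sound a⟶r root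
  in g [ a ↦ b ] , covers-insert {G = G} ga≡a g-covers
... | inj₂ _ | inj₁ (r , b⟶r , root) =
  let g , g-covers , gb≡b = reroot {G = deleteEdge a b G} covers sound b⟶r root
  in g [ b ↦ a ] , covers-insert {G = G} gb≡b
       λ {i} {j} e → g-covers (trans (deleteEdge-swap G a b i j) e)
... | inj₂ (c , a⟶c , ffc≢c , fc⟶c) | inj₂ (d , b⟶d , ffd≢d , fd⟶d) =
  let C , c∈C = orbitCycle {G = deleteEdge a b G} sound ffc≢c fc⟶c
      D , d∈D = orbitCycle {G = deleteEdge a b G} sound ffd≢d fd⟶d
  in ⊥-elim (no-two-cycles pf ab C D
       (orbit-connected (deleteEdge a b G) sound a⟶c) c∈C
       (orbit-connected (deleteEdge a b G) sound b⟶d) d∈D)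

-- Sequences of switches

private
  variable
    G H : Graph n

Move : Graph n → Graph n → Set
Move G H = G ≈ H ⊎ (Pseudoforest G × Pseudoforest H × ∃ λ A → Swap A G H)

infix 4 _↝_

_↝_ : Graph n → Graph n → Set
_↝_ = Star Move

↝-sym : G ↝ H → H ↝ G
↝-sym = Star.reverse move-sym
  where
  move-sym : Move G H → Move H G
  move-sym {G = G} {H} (inj₁ G≈H)                     = inj₁ (≈-sym {G = G} {H} G≈H)
  move-sym (inj₂ (pfG , pfH , matrix a b c d , σ))     = inj₂ (pfH , pfG , matrix a c b d , swap-sym σ)

-- `K` is the graph produced by the actual calls of `switch`; it follows the sequence up to `≈`, and
-- each switch is carried over to it.
↝⇒transforms : ∀ {K G H : Graph n} → K ≈ G → G ↝ H → TransformsByPSwitches K H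
↝⇒transforms {K = K} K≈G ε = K , ε , K≈G
↝⇒transforms K≈G (inj₁ G≈G′ ◅ G′↝H) = ↝⇒transforms (λ i j → trans (K≈G i j) (G≈G′ i j)) G′↝H
↝⇒transforms {K = K} {G} K≈G (_◅_ {j = G′} (inj₂ (pfG , pfG′ , A , σ)) G′↝H)
  with σ′ ← swap-cong {A = A} {G} {K} {G′} (≈-sym {G = K} {G} K≈G) σ
  with switched≈G′ ← (λ i j → trans (result (switch-swap A K (interchangeable σ′)) i j) (sym (result σ′ i j)))
  with K′ , K↝K′ , K′≈H ← ↝⇒transforms {K = switch A K} switched≈G′ G′↝H
  = K′ , (A , record
      { source     = Pseudoforest-≈ {G = G} {K} (≈-sym {G = K} {G} K≈G) pfG
      ; nontrivial = interchangeable σ′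
      ; target     = Pseudoforest-≈ {G = G′} {switch A K} (≈-sym {G = switch A K} {G′} switched≈G′) pfG′
      } , refl) ◅ K↝K′ , K′≈H

functional : Pseudoforest G → Functional G
functional {G = G} = pseudoforest⇒functional {G = G} (size G) ≤-refl

pseudoforest : Functional G → Pseudoforest G
pseudoforest {G = G} (f , covers) = covers⇒pseudoforest {G = G} covers

functional-insertEdge : ∀ {l z} (l≢z : l ≢ z) → Isolated l G → Functional G →
                        Functional (insertEdge l z l≢z G)
functional-insertEdge {G = G} {l} {z} l≢z iso (f , covers) = f [ l ↦ z ] , cover
  where
  cover : Covers (f [ l ↦ z ]) (insertEdge l z l≢z G)
  cover {i} {j} e with insertEdge⁻ G {a≢b = l≢z} e
  ... | inj₂ p  = covered-pair p (update-≡ f l)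
  ... | inj₁ ij with update-covered f {l} {z} (covers ij)
  ...   | inj₁ cov = cov
  ...   | inj₂ p   = contradiction (pair-edge⁻ G p ij) (iso (f l))

-- The vertex `l` stays isolated throughout, so its value covers nothing and may point to `z`: every
-- intermediate graph remains a pseudoforest with the pendant edge added.
↝-insertEdge : ∀ {l z} (l≢z : l ≢ z) → Isolated l G → G ↝ H → insertEdge l z l≢z G ↝ insertEdge l z l≢z H
↝-insertEdge l≢z iso ε = ε
↝-insertEdge {G = G} l≢z iso (_◅_ {j = G′} (inj₁ G≈G′) G′↝H) =
  inj₁ (insertEdge-cong {G = G} {G′} {a≢b = l≢z} G≈G′) ◅
  ↝-insertEdge l≢z (λ j e → iso j (trans (G≈G′ _ j) e)) G′↝H
↝-insertEdge {n} {G} l≢z iso (_◅_ {j = G′} (inj₂ (pfG , pfG′ , A , σ)) G′↝H) =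
  let iso′ , σ′ = swap-insertEdge l≢z iso σ
  in inj₂ (insert G iso pfG , insert G′ iso′ pfG′ , A , σ′) ◅ ↝-insertEdge l≢z iso′ G′↝H
  where
  insert : ∀ (G : Graph n) → Isolated _ G → Pseudoforest G → Pseudoforest (insertEdge _ _ l≢z G)
  insert G iso pf = pseudoforest {G = insertEdge _ _ l≢z G}
    (functional-insertEdge {G = G} l≢z iso (functional {G = G} pf))

-- Finding and relocating a leaf

two-children : ∀ {G : Graph n} {f z} → Covers f G → 3 ≤ degree G z →
  ∃₂ λ w w′ → w ≢ w′ × (Edge G z w × f w ≡ z) × (Edge G z w′ × f w′ ≡ z)
two-children {G = G} {f} {z} covers 3≤deg =
  let w  , w∈  = count>0 (≤-trans (s≤s z≤n) two)
      w′ , w′∈ = count>0 (≤-trans (∸-monoˡ-≤ 1 two) (count-∖-∸ {p = others} {w}))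
      w′∈others , w′≢w = ∖⁻ others w′∈
  in w , w′ , w′≢w ∘ sym , child w∈ , child w′∈others
  where
  -- The value of `z` covers at most one of its edges; the neighbours at the others point to `z`.
  others = adj G z ∖ f z

  two : 2 ≤ count others
  two = ≤-trans (∸-monoˡ-≤ 1 3≤deg) (count-∖-∸ {p = adj G z})

  child : ∀ {w} → others w ≡ true → Edge G z w × f w ≡ z
  child w∈ with zw , w≢fz ← ∖⁻ (adj G z) w∈ | covers zw
  ... | inj₁ fz≡w = contradiction (sym fz≡w) w≢fz
  ... | inj₂ fw≡z = zw , fw≡z

-- If every vertex had a preimage, a choice `g` of preimages would be injective and miss `w` or
-- `w′`. Adding the missed vertex gives an injection `h` from `suc n` into `n` elements.
not-surjective : ∀ (f : Fin n → Fin n) {w w′} → w ≢ w′ → f w ≡ f w′ → ∃ λ l → ∀ y → f y ≢ l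
not-surjective {n} f {w} {w′} w≢w′ fw≡fw′ with any? (λ l → ¬? (any? (λ y → f y ≟ l)))
... | yes (l , none) = l , λ y fy≡l → none (y , fy≡l)
... | no surjective = ⊥-elim (collision (pigeonhole (n<1+n n) h))
  where
  preimage : ∀ l → ∃ λ y → f y ≡ l
  preimage l = decidable-stable (any? (λ y → f y ≟ l)) (λ none → surjective (l , none))

  g : Fin n → Fin n
  g = proj₁ ∘ preimage

  missed : ∃ λ m → ∀ y → g y ≢ m
  missed with g (f w) ≟ w
  ... | no gfw≢w  = w , λ y gy≡w → gfw≢w
    (trans (cong g (trans (cong f (sym gy≡w)) (proj₂ (preimage y)))) gy≡w)
  ... | yes gfw≡w = w′ , λ y gy≡w′ → w≢w′
    (trans (sym gfw≡w) (trans (cong g (trans fw≡fw′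
      (trans (cong f (sym gy≡w′)) (proj₂ (preimage y))))) gy≡w′))

  h : Fin (suc n) → Fin n
  h zero    = proj₁ missed
  h (suc y) = g y

  collision : (∃₂ λ i j → i Fin.< j × h i ≡ h j) → ⊥
  collision (zero  , suc y , _   , m≡gy)   = proj₂ missed y (sym m≡gy)
  collision (suc x , suc y , x<y , gx≡gy) = Fin.<⇒≢ x<y (cong suc
    (trans (sym (proj₂ (preimage x))) (trans (cong f gx≡gy) (proj₂ (preimage y)))))

-- Outside the image, only `f l` can cover edges at `l`. Since `f l ≢ l`, soundness supplies that
-- edge, so `l` is not isolated.
leaf-exists : ∀ {z} → Functional G → 3 ≤ degree G z → ∃ λ l → degree G l ≡ 1
leaf-exists {G = G} fun 3≤deg
  with f , covers , sound ← soundCover {G = G} fun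
  with w , w′ , w≢w′ , (_ , fw≡z) , (_ , fw′≡z) ← two-children {G = G} covers 3≤deg
  with l , none ← not-surjective f w≢w′ (trans fw≡z (sym fw′≡z))
  = l , unique⇒count≡1 {p = adj G l} (sound l (none l)) λ j lj →
      [ sym , (λ fj≡l → contradiction fj≡l (none j)) ]′ (covers lj)

Relocated : Graph n → Fin n → Fin n → Set
Relocated G l z = ∃ λ H → G ↝ H × Functional H × (∀ i → degree G i ≡ degree H i) × Edge H l z

module _ {n} {G : Graph n} {l z : Fin n} (fun : Functional G)
         (leaf : degree G l ≡ 1) (3≤deg : 3 ≤ degree G z) where

  private
    f = proj₁ fun

    covers : Covers f G
    covers = proj₂ fun

    only : ∀ {u j} → Edge G l u → Edge G l j → j ≡ u
    only = count≡1⇒unique {p = adj G l} leaf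

    l≢z : l ≢ z
    l≢z refl = contradiction (subst (3 ≤_) leaf 3≤deg) λ { (s≤s ()) }

    not-adjacent : ∀ {u w} → u ≢ z → f w ≡ z → f u ≢ w → ¬ Edge G u w
    not-adjacent u≢z fw≡z fu≢w uw with covers uw
    ... | inj₁ fu≡w = fu≢w fu≡w
    ... | inj₂ fw≡u = u≢z (trans (sym fw≡u) fw≡z)

    -- A child of z that is u or adjacent to u equals u or f u; two such children are
    -- never distinct, because f u = z if u is a child.
    good-child : ∀ u → u ≢ z → ∃ λ w → (Edge G z w × f w ≡ z) × w ≢ u × ¬ Edge G u w
    good-child u u≢z
      with w , w′ , w≢w′ , wc@(zw , fw≡z) , wc′@(zw′ , fw′≡z) ← two-children {G = G} covers 3≤deg
      with w ≟ u | f u ≟ w | w′ ≟ u | f u ≟ w′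
    ... | no w≢u   | no fu≢w | _         | _          = w , wc , w≢u , not-adjacent u≢z fw≡z fu≢w
    ... | _        | _       | no w′≢u   | no fu≢w′   = w′ , wc′ , w′≢u , not-adjacent u≢z fw′≡z fu≢w′
    ... | yes w≡u  | _       | yes w′≡u  | _          = contradiction (trans w≡u (sym w′≡u)) w≢w′
    ... | yes refl | _       | no _      | yes fw≡w′  = contradiction (trans (sym fw≡z) fw≡w′) (edge⇒≢ G zw′)
    ... | no _     | yes fu≡w | yes refl | _          = contradiction (trans (sym fw′≡z) fu≡w) (edge⇒≢ G zw)
    ... | no _     | yes fu≡w | no _     | yes fu≡w′  = contradiction (trans (sym fu≡w) fu≡w′) w≢w′

    relocate : ∀ {u w} → Edge G l u → u ≢ z → Edge G z w → f w ≡ z → w ≢ u → ¬ Edge G u w → Relocated G l z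
    relocate {u} {w} lu u≢z zw fw≡z w≢u ¬uw =
      G′ , inj₂ (pseudoforest {G = G} fun , pseudoforest {G = G′} (h , cover) , _ , σ) ◅ ε
        , (h , cover) , swap-degree σ , swap-new₁ σ
      where
      w≢l : w ≢ l
      w≢l refl = u≢z (sym (only lu (edge-sym G zw)))

      G′ = switch (matrix l u z w) G
      -- The two redirected values cover the inserted edges. The values they replace could cover
      -- only the removed edges `z w` and `l u`.
      g = f [ w ↦ u ]
      h = g [ l ↦ z ]

      σ : Swap (matrix l u z w) G G′
      σ = switch-swap (matrix l u z w) G
        ((lu , zw) , (l≢z , w≢l ∘ sym , u≢z , w≢u ∘ sym) , (λ lz → u≢z (sym (only lu lz))) , ¬uw)

      cover : Covers h G′
      cover {i} {j} e with swap⁻ σ e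
      ... | inj₂ (inj₁ lz) = covered-pair lz (update-≡ g l)
      ... | inj₂ (inj₂ uw) = covered-pair (pair-swap uw) (trans (update-≢ g w≢l) (update-≡ f w))
      ... | inj₁ (ij , ¬lu , ¬zw) with update-covered f {w} {u} (covers ij)
      ...   | inj₂ wfw = contradiction (pair-swap (subst (λ x → Pair w x i j) fw≡z wfw)) ¬zw
      ...   | inj₁ cov with update-covered g {l} {z} cov
      ...     | inj₁ cov′ = cov′
      ...     | inj₂ lgl  = contradiction (subst (λ x → Pair l x i j) (only lu (pair-edge⁻ G lgl ij)) lgl) ¬lu

  move-leaf : Relocated G l z
  move-leaf with u , lu ← count>0 {p = adj G l} (subst (0 <_) (sym leaf) (s≤s z≤n)) | u ≟ z
  ... | yes refl = G , ε , fun , (λ _ → refl) , lu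
  ... | no u≢z =
    let w , (zw , fw≡z) , w≢u , ¬uw = good-child u u≢z
    in relocate lu u≢z zw fw≡z w≢u ¬uw

-- Aligning adjacency rows one vertex at a time

within : List (Fin n) → BoolPred n
within L j = does (j ∈? L)

degreeIn : List (Fin n) → Graph n → Fin n → ℕ
degreeIn L G v = count (λ j → adj G v j ∧ within L j)

-- `L` lists the vertices that are still unprocessed.
AgreeOff : List (Fin n) → Graph n → Graph n → Set
AgreeOff L G H = ∀ {i} → i ∉ L → ∀ j → adj G i j ≡ adj H i j

-- By symmetry of adjacency, the processed vertices contribute the same number to both degrees of
-- `v`.
degreeIn-agree : ∀ {L} → (∀ i → degree G i ≡ degree H i) → AgreeOff L G H →
                 ∀ v → degreeIn L G v ≡ degreeIn L H v
degreeIn-agree {G = G} {H} {L} G≡H agree v = +-cancelʳ-≡ _ _ _ (begin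
  degreeIn L G v + count (λ j → adj G v j ∧ not (within L j)) ≡⟨ count-split (adj G v) (within L) ⟨
  degree G v                                                  ≡⟨ G≡H v ⟩
  degree H v                                                  ≡⟨ count-split (adj H v) (within L) ⟩
  degreeIn L H v + count (λ j → adj H v j ∧ not (within L j)) ≡⟨ cong (degreeIn L H v +_) (count-cong outside) ⟨
  degreeIn L H v + count (λ j → adj G v j ∧ not (within L j)) ∎)
  where
  open ≡-Reasoning
  outside : ∀ j → adj G v j ∧ not (within L j) ≡ adj H v j ∧ not (within L j)
  outside j with j ∈? L
  ... | yes _  = trans (Bool.∧-zeroʳ _) (sym (Bool.∧-zeroʳ _))
  ... | no j∉L = cong (_∧ true) (trans (adj-sym G v j) (trans (agree j∉L v) (adj-sym H j v)))

-- Within `L`, `v` has at least as many neighbours as `u`, and `x` is adjacent to `u` only, so some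
-- `w` is adjacent to `v` only. Setting `u` and `v` aside first ensures `w ≢ u`; it preserves the
-- inequality because their adjacency is mutual.
swap-exists : ∀ {L x u v} → x ∈ˡ L → u ∈ˡ L → v ∈ˡ L → u ≢ v → x ≢ v → Edge G x u → ¬ Edge G x v →
              degreeIn L G u ≤ degreeIn L G v → ∃ λ w → w ∈ˡ L × ∃ λ H → Swap (matrix x u v w) G H
swap-exists {G = G} {L} {x} {u} {v} x∈ u∈ v∈ u≢v x≢v xu ¬xv du≤dv =
  let w , w∈p , w∉q = count-swap {p = p ∖ u} {q ∖ v} {x}
        (count-∖-mono {p = q} {p} du≤dv λ e →
          ∧⁺ (edge-sym G (proj₁ (∧⁻ {adj G v u} e))) (dec-true (v ∈? L) v∈))
        (∖⁺ q (∧⁺ (edge-sym G xu) (dec-true (x ∈? L) x∈)) x≢v)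
        (λ e → ¬xv (edge-sym G (proj₁ (∧⁻ {adj G v x} (proj₁ (∖⁻ p e))))))
      w∈p′ , w≢u = ∖⁻ p w∈p
      vw , w∈L   = ∧⁻ {adj G v w} w∈p′
  in w , does⁻ (w ∈? L) w∈L , switch (matrix x u v w) G , switch-swap (matrix x u v w) G
       ( (xu , vw)
       , (x≢v , (λ x≡w → ¬xv (edge-sym G (trans (cong (adj G v) x≡w) vw))) , u≢v , w≢u ∘ sym)
       , ¬xv , λ uw → w∉q (∖⁺ q (∧⁺ uw w∈L) (edge⇒≢ G vw ∘ sym)) )
  where
  p q : BoolPred _
  p j = adj G v j ∧ within L j
  q j = adj G u j ∧ within L j

swap-row : ∀ {x u v w j} → Swap (matrix x u v w) G H → Edge H x j → j ≡ v ⊎ (Edge G x j × j ≢ u)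
swap-row {G = G} σ xj with ((xu , _) , (_ , x≢w , _) , _) ← interchangeable σ | swap⁻ σ xj
... | inj₁ (e , ¬xu , _)             = inj₂ (e , λ j≡u → ¬xu (inj₁ (refl , j≡u)))
... | inj₂ (inj₁ (inj₁ (_ , j≡v)))   = inj₁ j≡v
... | inj₂ (inj₁ (inj₂ (j≡x , x≡v))) = inj₁ (trans j≡x x≡v)
... | inj₂ (inj₂ (inj₁ (x≡u , _)))   = contradiction x≡u (edge⇒≢ G xu)
... | inj₂ (inj₂ (inj₂ (_ , x≡w)))   = contradiction x≡w x≢w

excess : Graph n → Graph n → Fin n → BoolPred n
excess G H x j = adj G x j ∧ not (adj H x j)

swap-AgreeOff : ∀ {L a b c d G′} → a ∈ˡ L → b ∈ˡ L → c ∈ˡ L → d ∈ˡ L →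
                Swap (matrix a b c d) G G′ → AgreeOff L G H → AgreeOff L G′ H
swap-AgreeOff a∈ b∈ c∈ d∈ σ agree i∉ j = trans
  (sym (swap-off σ (λ { refl → i∉ a∈ }) (λ { refl → i∉ b∈ }) (λ { refl → i∉ c∈ }) (λ { refl → i∉ d∈ }) j))
  (agree i∉ j)

-- The row of `x` loses the surplus neighbour `u`, and the neighbour `v` gained is one that `H` has
-- too.
excess-swapˡ : ∀ {x u v w G′} → Swap (matrix x u v w) G G′ → Edge H x v → ¬ Edge H x u →
               count (excess G′ H x) < count (excess G H x)
excess-swapˡ {G = G} {H = H} {x} {u} {v} {G′ = G′} σ xvH ¬xuH =
  count-<-mono {p = excess G′ H x} {excess G H x} sub
    (∧⁺ (proj₁ (proj₁ (interchangeable σ))) (not⁺ ¬xuH))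
    (λ e → gone (swap-row σ (proj₁ (∧⁻ {adj G′ x u} e))))
  where
  sub : excess G′ H x ⊆ᵇ excess G H x
  sub j e with xj′ , ¬xjH ← ∧⁻ {adj G′ x j} e | swap-row σ xj′
  ... | inj₁ refl     = contradiction xvH (not⁻ ¬xjH)
  ... | inj₂ (xj , _) = ∧⁺ xj ¬xjH

  gone : u ≡ v ⊎ (Edge G x u × u ≢ u) → ⊥
  gone (inj₁ refl)      = ¬xuH xvH
  gone (inj₂ (_ , u≢u)) = u≢u refl

-- Now `H` gains `u`, and the neighbour `v` that it gives up is absent in `G`, so no new excess
-- arises.
excess-swapʳ : ∀ {x u v w H′} → Swap (matrix x v u w) H H′ → Edge G x u → ¬ Edge G x v →
               count (excess G H′ x) < count (excess G H x)
excess-swapʳ {H = H} {G = G} {x} {u} {v} {H′ = H′} σ xu ¬xv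
  with ((xvH , uwH) , (x≢u , x≢w , _) , ¬xuH , _) ← interchangeable σ =
  count-<-mono {p = excess G H′ x} {excess G H x}
    (λ j e → let xj , ¬xjH′ = ∧⁻ {adj G x j} e in ∧⁺ xj (not⁺ λ xjH → not⁻ ¬xjH′ (swap-keep σ xjH
      (λ { (inj₁ (_ , refl)) → ¬xv xj ; (inj₂ (refl , _)) → edge⇒≢ H xjH refl })
      (λ { (inj₁ (x≡u , _)) → x≢u x≡u ; (inj₂ (_ , x≡w)) → x≢w x≡w }))))
    (∧⁺ xu (not⁺ ¬xuH))
    (λ e → not⁻ (proj₂ (∧⁻ {adj G x u} e)) (swap-new₁ σ))

row-agrees : ∀ {x} → degree G x ≡ degree H x → (∀ j → ¬ (excess G H x j ≡ true)) →
             ∀ j → adj G x j ≡ adj H x j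
row-agrees {G = G} {H} {x} degrees none j = ⇔⇒≡ (G⊆H j) λ xjH →
  decidable-stable (adj G x j Bool.≟ true) λ ¬xj →
    <⇒≢ (count-<-mono {p = adj G x} {adj H x} G⊆H xjH ¬xj) degrees
  where
  G⊆H : adj G x ⊆ᵇ adj H x
  G⊆H j xj = decidable-stable (adj H x j Bool.≟ true) λ ¬xjH → none j (∧⁺ xj (not⁺ ¬xjH))

swap-move : ∀ {A : Matrix n} → (∀ i → degree G i ≤ 2) → Swap A G H → G ↝ H
swap-move {G = G} {H} deg≤2 σ = inj₂
  ( degree≤2⇒pseudoforest {G = G} deg≤2
  , degree≤2⇒pseudoforest {G = H} (λ i → subst (_≤ 2) (swap-degree σ i) (deg≤2 i))
  , _ , σ ) ◅ ε

mutual

  connect-off : ∀ L (G H : Graph n) → (∀ i → degree G i ≤ 2) → (∀ i → degree G i ≡ degree H i) →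
                AgreeOff L G H → G ↝ H
  connect-off []      G H deg≤2 G≡H agree = inj₁ (λ i → agree {i} λ ()) ◅ ε
  connect-off (x ∷ L) G H deg≤2 G≡H agree =
    align x L (count (excess G H x)) G H deg≤2 G≡H agree ≤-refl

  -- The bound `m` falls with each switch. Both `u` and `v` are unprocessed because processed rows
  -- agree, and their degrees within `x ∷ L` are the same in both graphs, so a switch is available
  -- in `G` or in `H`.
  align : ∀ x L m (G H : Graph n) → (∀ i → degree G i ≤ 2) → (∀ i → degree G i ≡ degree H i) →
          AgreeOff (x ∷ L) G H → count (excess G H x) ≤ m → G ↝ H
  align x L m G H deg≤2 G≡H agree bound with any? (λ u → excess G H x u Bool.≟ true)
  align x L m G H deg≤2 G≡H agree bound | no none = connect-off L G H deg≤2 G≡H agree′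
    where
    agree′ : AgreeOff L G H
    agree′ {i} i∉L with i ≟ x
    ... | yes refl = row-agrees {G = G} {H} (G≡H x) (λ j e → none (j , e))
    ... | no i≢x   = agree λ { (here i≡x) → i≢x i≡x ; (there i∈L) → i∉L i∈L }
  align x L zero G H deg≤2 G≡H agree bound | yes (u , u∈) =
    contradiction (subst (_≤ 0) (count-∖ {p = excess G H x} u∈) bound) λ ()
  align x L (suc m) G H deg≤2 G≡H agree bound | yes (u , u∈)
    with xu , ¬xuH′ ← ∧⁻ {adj G x u} u∈
    with ¬xuH ← not⁻ ¬xuH′
    with v , xvH , ¬xv ← count-swap {p = adj H x} {adj G x} (≤-reflexive (G≡H x)) xu ¬xuH
    = by-cases (≤-total (degreeIn (x ∷ L) G u) (degreeIn (x ∷ L) G v))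
    where
    u∈L : u ∈ˡ x ∷ L
    u∈L = decidable-stable (u ∈? (x ∷ L)) λ u∉ →
      ¬xuH (edge-sym H (trans (sym (agree u∉ x)) (edge-sym G xu)))

    v∈L : v ∈ˡ x ∷ L
    v∈L = decidable-stable (v ∈? (x ∷ L)) λ v∉ →
      ¬xv (edge-sym G (trans (agree v∉ x) (edge-sym H xvH)))

    u≢v : u ≢ v
    u≢v refl = ¬xv xu

    degreesIn : ∀ i → degreeIn (x ∷ L) G i ≡ degreeIn (x ∷ L) H i
    degreesIn = degreeIn-agree {G = G} {H} {x ∷ L} G≡H agree

    by-cases : _ ⊎ _ → G ↝ H
    by-cases (inj₁ du≤dv) =
      let w , w∈L , G′ , σ = swap-exists {G = G} (here refl) u∈L v∈L u≢v (edge⇒≢ H xvH) xu ¬xv du≤dv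
      in swap-move deg≤2 σ ◅◅ align x L m G′ H
           (λ i → subst (_≤ 2) (swap-degree σ i) (deg≤2 i))
           (λ i → trans (sym (swap-degree σ i)) (G≡H i))
           (swap-AgreeOff {H = H} (here refl) u∈L v∈L w∈L σ agree)
           (≤-pred (<-≤-trans (excess-swapˡ {H = H} σ xvH ¬xuH) bound))
    by-cases (inj₂ dv≤du) =
      let w , w∈L , H′ , σ = swap-exists {G = H} (here refl) v∈L u∈L (u≢v ∘ sym) (edge⇒≢ G xu) xvH ¬xuH
                               (subst₂ _≤_ (degreesIn v) (degreesIn u) dv≤du)
      in align x L m G H′ deg≤2
           (λ i → trans (G≡H i) (swap-degree σ i))
           (λ i∉ j → sym (swap-AgreeOff {H = G} (here refl) v∈L u∈L w∈L σ (λ i∉ j → sym (agree i∉ j)) i∉ j))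
           (≤-pred (<-≤-trans (excess-swapʳ {G = G} σ xu ¬xv) bound))
         -- The switch starts from `H`, so it comes last and is run backwards.
         ◅◅ ↝-sym (swap-move (λ i → subst (_≤ 2) (G≡H i) (deg≤2 i)) σ)

-- The induction on edges

size-cong : (∀ i → degree G i ≡ degree H i) → size G ≡ size H
size-cong G≡H = cong Vec.sum (tabulate-cong G≡H)

isolated-deleteEdge : ∀ {l z} → degree G l ≡ 1 → Edge G l z → Isolated l (deleteEdge l z G)
isolated-deleteEdge {G = G} {l} leaf lz j lj with lj′ , ¬p ← deleteEdge⁻ G lj =
  ¬p (inj₁ (refl , count≡1⇒unique {p = adj G l} leaf lz lj′))

functional-deleteEdge : ∀ {a b} → Functional G → Functional (deleteEdge a b G)
functional-deleteEdge {G = G} (f , covers) = f , covers ∘ proj₁ ∘ deleteEdge⁻ G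

connect : ∀ m (G H : Graph n) → size G ≤ m → Functional G → Functional H →
          (∀ i → degree G i ≡ degree H i) → G ↝ H

-- This is where `m` decreases. Deleting the common pendant edge isolates `l`, so the sequence found
-- for the smaller graphs survives its reinsertion.
connect-pendant : ∀ m (G H : Graph n) {l z} → size G ≤ m → Functional G → Functional H →
                  (∀ i → degree G i ≡ degree H i) → degree G l ≡ 1 →
                  Edge G l z → Edge H l z → G ↝ H
connect-pendant zero G H bound _ _ _ _ lzG _ = contradiction (<-≤-trans (size-deleteEdge G lzG) bound) λ ()
connect-pendant {n} (suc m) G H {l} {z} bound funG funH G≡H leaf lzG lzH =
  inj₁ (≈-sym {G = insertEdge l z l≢z G₀} {G} (insert-delete {G = G} l≢z lzG)) ◅
  ↝-insertEdge l≢z (isolated-deleteEdge {G = G} leaf lzG) G₀↝H₀ ◅◅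
  inj₁ (insert-delete {G = H} l≢z lzH) ◅ ε
  where
  G₀ H₀ : Graph n
  G₀ = deleteEdge l z G
  H₀ = deleteEdge l z H

  l≢z : l ≢ z
  l≢z = edge⇒≢ G lzG

  G₀↝H₀ : G₀ ↝ H₀
  G₀↝H₀ = connect m G₀ H₀ (≤-pred (<-≤-trans (size-deleteEdge G lzG) bound))
    (functional-deleteEdge {G = G} funG) (functional-deleteEdge {G = H} funH)
    (degree-deleteEdge G H lzG lzH G≡H)

connect m G H bound funG funH G≡H with any? (λ z → 3 ≤? degree G z)
connect {n} m G H bound funG funH G≡H | no small =
  -- Initially every vertex is unprocessed, so agreement elsewhere is vacuous.
  connect-off (allFin n) G H (λ i → ≤-pred (≰⇒> λ 3≤deg → small (i , 3≤deg))) G≡H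
    λ i∉ → contradiction (∈-allFin _) i∉
connect m G H bound funG funH G≡H | yes (z , 3≤deg) = via-leaf (leaf-exists {G = G} funG 3≤deg)
  where
  via-moved : ∀ {l} → degree G l ≡ 1 → Relocated G l z → Relocated H l z → G ↝ H
  via-moved leaf (G₁ , G↝G₁ , funG₁ , G≡G₁ , lzG₁) (H₁ , H↝H₁ , funH₁ , H≡H₁ , lzH₁) =
    G↝G₁ ◅◅ connect-pendant m G₁ H₁ (subst (_≤ m) (size-cong {G = G} {G₁} G≡G₁) bound) funG₁ funH₁
      (λ i → trans (sym (G≡G₁ i)) (trans (G≡H i) (H≡H₁ i))) (trans (sym (G≡G₁ _)) leaf) lzG₁ lzH₁
    ◅◅ ↝-sym H↝H₁
  via-leaf : (∃ λ l → degree G l ≡ 1) → G ↝ H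
  via-leaf (l , leaf) = via-moved leaf
    (move-leaf funG leaf 3≤deg)
    (move-leaf funH (trans (sym (G≡H l)) leaf) (subst (3 ≤_) (G≡H z) 3≤deg))

theorem5p7 : ∀ (n : ℕ) (s : Vec ℕ n) → IsDegreeSequence s →
    ∀ (G H : Graph n) → G ∈ 𝒫 s → H ∈ 𝒫 s →
    TransformsByPSwitches G H
theorem5p7 n s _ G H (pfG , degG) (pfH , degH) = ↝⇒transforms (λ _ _ → refl)
  (connect (size G) G H ≤-refl (functional {G = G} pfG) (functional {G = H} pfH) λ i → begin
    degree G i                    ≡⟨ lookup∘tabulate (degree G) i ⟨
    lookup (degreeSequence G) i   ≡⟨ cong (λ t → lookup t i) (trans degG (sym degH)) ⟩
    lookup (degreeSequence H) i   ≡⟨ lookup∘tabulate (degree H) i ⟩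
    degree H i                    ∎)
  where open ≡-Reasoning
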